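{- Let $F$ be a field with algebraic closure $\overline{F}$, and let $A\in F^{r\times r}$ and $B\in F^{s\times s}$. Then (a) $\sum_{\alpha\in\overline{F}}k_{A,\alpha}k_{B,\alpha}\le\dim(C(A,B))\le\sum_{\alpha\in\overline{F}}m_{A,\alpha}m_{B,\alpha}$, and (b) $(r-\mathrm{Rk}(A))(s-\mathrm{Rk}(B))\le\dim(C(A,B))\le(r-\mathrm{Rk}(A))(s-\mathrm{Rk}(B))+\mathrm{Rk}(A)\mathrm{Rk}(B)$.
   Context: $C(A,B):=\{X\in F^{r\times s}\mid AX=XB\}$, with dimension over $F$. Viewing $A$ as acting on $\overline{F}^r$, for $\alpha\in\overline{F}$, $k_{A,\alpha}$ is the dimension of the $\alpha$-eigenspace of $A$ and $m_{A,\alpha}$ is the dimension of the generalized $\alpha$-eigenspace of $A$ (so $c_A(t)=\prod_\alpha(t-\alpha)^{m_{A,\alpha}}$); similarly for $B$. These are nonzero for only finitely many $\alpha$. $\mathrm{Rk}$ denotes matrix rank. -}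

module Defs where

open import Level using (Level; _⊔_; suc)
open import Algebra.Bundles using (CommutativeRing)
open import Data.Nat as ℕ using (ℕ; zero) renaming (suc to 1+)
open import Data.Fin using (Fin; toℕ)
import Data.Fin as FinM
open import Data.Product using (Σ; ∃; _×_; _,_)
open import Data.List using (List; map)
open import Data.Nat.ListAction using (sum)
open import Data.List.Relation.Unary.Any using (Any)
open import Data.List.Relation.Unary.AllPairs using (AllPairs)
open import Relation.Nullary using (¬_)
open import Relation.Binary.PropositionalEquality using (_≡_)

record Field (c ℓ : Level) : Set (suc (c ⊔ ℓ)) where
  field
    commutativeRing : CommutativeRing c ℓ
  open CommutativeRing commutativeRing public
  field
    0≉1     : ¬ (0# ≈ 1#)
    inverse : ∀ x → ¬ (x ≈ 0#) → ∃ λ y → (x * y) ≈ 1#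

-- Generic linear algebra over a field, with vectors as functions I → K
-- (pointwise setoid equality).

module LinAlg {c ℓ} (K : Field c ℓ) where
  open Field K

  Σ[<] : (n : ℕ) → (Fin n → Carrier) → Carrier
  Σ[<] zero    f = 0#
  Σ[<] (1+ n) f = f FinM.zero + Σ[<] n (λ i → f (FinM.suc i))

  pow : Carrier → ℕ → Carrier
  pow x zero    = 1#
  pow x (1+ n) = x * pow x n

  -- a "subspace" of I → K is given by its membership predicate
  -- linear combination Σ_i c_i b_i of d vectors in I → K
  lincomb : ∀ {i} {I : Set i} (d : ℕ) → (Fin d → Carrier) → (Fin d → I → Carrier) → I → Carrier
  lincomb d cs b x = Σ[<] d (λ k → cs k * b k x)

  IsDim : ∀ {i p} {I : Set i} → ((I → Carrier) → Set p) → ℕ → Set (c ⊔ ℓ ⊔ i ⊔ p)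
  IsDim {I = I} P d =
    Σ (Fin d → I → Carrier) λ b →
      (∀ k → P (b k)) ×
      (∀ (cs : Fin d → Carrier) → (∀ x → lincomb d cs b x ≈ 0#) → ∀ k → cs k ≈ 0#) ×
      (∀ v → P v → ∃ λ (cs : Fin d → Carrier) → ∀ x → v x ≈ lincomb d cs b x)

  Mat : ℕ → ℕ → Set c
  Mat r s = Fin r → Fin s → Carrier

  _·_ : ∀ {r s} → Mat r s → (Fin s → Carrier) → Fin r → Carrier
  _·_ {s = s} M v i = Σ[<] s (λ j → M i j * v j)

  Image : ∀ {r s} → Mat r s → (Fin r → Carrier) → Set (c ⊔ ℓ)
  Image M v = ∃ λ x → ∀ i → (M · x) i ≈ v i

  IsRank : ∀ {r s} → Mat r s → ℕ → Set (c ⊔ ℓ)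
  IsRank M = IsDim (Image M)

  Commutant : ∀ {r s} → Mat r r → Mat s s → (Fin r × Fin s → Carrier) → Set ℓ
  Commutant {r} {s} A B X =
    ∀ i j → Σ[<] r (λ k → A i k * X (k , j)) ≈ Σ[<] s (λ k → X (i , k) * B k j)

  shift : ∀ {r} → Mat r r → Carrier → (Fin r → Carrier) → Fin r → Carrier
  shift M α v i = (M · v) i - α * v i

  iter : ∀ {a} {X : Set a} → ℕ → (X → X) → X → X
  iter zero    f x = x
  iter (1+ n) f x = f (iter n f x)

  Eigenspace : ∀ {r} → Mat r r → Carrier → (Fin r → Carrier) → Set ℓ
  Eigenspace M α v = ∀ i → (M · v) i ≈ α * v i

  GenEigenspace : ∀ {r} → Mat r r → Carrier → (Fin r → Carrier) → Set ℓ
  GenEigenspace M α v = ∃ λ n → ∀ i → iter n (shift M α) v i ≈ 0#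

  -- Sum over α ∈ K of a function f : K → ℕ of finite support:
  -- FinSupSum f n  means n = Σ_{α ∈ l} f α for some list l of pairwise
  -- distinct elements of K containing every α with f α ≠ 0.
  FinSupSum : (Carrier → ℕ) → ℕ → Set (c ⊔ ℓ)
  FinSupSum f n =
    Σ (List Carrier) λ l →
      AllPairs (λ x y → ¬ (x ≈ y)) l ×
      (∀ α → ¬ (f α ≡ 0) → Any (α ≈_) l) ×
      (n ≡ sum (map f l))

record AlgebraicClosure {c ℓ} (F : Field c ℓ) (c' ℓ' : Level) : Set (suc (c ⊔ ℓ ⊔ c' ⊔ ℓ')) where
  field
    K : Field c' ℓ'
  private
    module F = Field F
    module K = Field K
    open LinAlg K
  field
    ι        : F.Carrier → K.Carrier
    ι-cong   : ∀ {x y} → x F.≈ y → ι x K.≈ ι y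
    ι-+      : ∀ x y → ι (x F.+ y) K.≈ (ι x K.+ ι y)
    ι-*      : ∀ x y → ι (x F.* y) K.≈ (ι x K.* ι y)
    ι-1      : ι F.1# K.≈ K.1#
    algClosed : ∀ (n : ℕ) (a : Fin (1+ n) → K.Carrier) →
                ∃ λ x → (pow x (1+ n) K.+ Σ[<] (1+ n) (λ i → a i K.* pow x (toℕ i))) K.≈ K.0#
    algebraic : ∀ (x : K.Carrier) → ∃ λ (n : ℕ) → ∃ λ (a : Fin n → F.Carrier) →
                (pow x n K.+ Σ[<] n (λ i → ι (a i) K.* pow x (toℕ i))) K.≈ K.0#

liftMat : ∀ {c ℓ c' ℓ'} {F : Field c ℓ} (Fb : AlgebraicClosure F c' ℓ') {r s : ℕ} →
          LinAlg.Mat F r s → LinAlg.Mat (AlgebraicClosure.K Fb) r s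
liftMat Fb M i j = AlgebraicClosure.ι Fb (M i j)

{-# OPTIONS --safe #-}
-- Equality in a field need not be decidable, but the conclusions are inequalities in ℕ, hence stable
-- under double negation; so Gaussian elimination may be carried out inside ¬ ¬.
--
-- (b) For A = C R and B = C′ R′ rank factorizations, every matrix U Y W with im U = ker A and W B = 0
-- commutes, giving the lower bound.  For the upper bound, restriction to im B maps the commutant to
-- Hom(im B, im A), and its kernel {X | XB = 0 = AX} is Hom(coker B, ker A).
--
-- (a) A basis of the commutant over F is one over K, because kernels of matrices are images of
-- projections defined over F.  Lower bound: the matrices U_α Y W_α, for U_α spanning ker (A − α) and W_α
-- the left kernel of B − α, are independent for distinct α since AX = αX on them.  Upper bound: X
-- maps the generalized β-eigenspace of B to that of A, and these span K^s since every vector is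
-- annihilated by a product of factors B − α.
module Submission where

open import Defs
open import Level as Level using (_⊔_)
open import Data.Nat as ℕ using (ℕ; zero; suc; z≤n; s≤s)
import Data.Nat.Properties as ℕₚ
open import Data.Nat.ListAction using (sum)
open import Data.Fin as Fin using (Fin; zero; suc; toℕ; fromℕ; inject₁; punchIn; punchOut)
import Data.Fin.Properties as Finₚ
open import Data.Fin.Relation.Unary.Top using (View; view; ‵fromℕ; ‵inject₁)
open import Data.List using (List; []; _∷_; map)
open import Data.List.Membership.Propositional using (_∈_)
open import Data.List.Relation.Unary.Any using (Any; here; there)
open import Data.List.Relation.Unary.All as All using (All; []; _∷_)
open import Data.List.Relation.Unary.AllPairs using (AllPairs; []; _∷_)
open import Data.Product using (Σ; ∃; _×_; _,_; proj₁; proj₂)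
open import Data.Sum as Sum using (_⊎_; inj₁; inj₂)
open import Data.Sum.Function.Propositional using (_⊎-↔_)
open import Data.Unit using (⊤; tt)
open import Function using (_∘_; _↔_; Inverse)
open import Function.Properties.Inverse using (↔-refl; ↔-trans)
open import Relation.Nullary using (¬_; yes; no; contradiction)
open import Relation.Nullary.Decidable using (decidable-stable; ¬¬-excluded-middle; _×-dec_)
open import Relation.Binary.PropositionalEquality as ≡ using (_≡_)
import Algebra.Properties.Ring
import Algebra.Properties.AbelianGroup
import Algebra.Properties.CommutativeSemigroup
import Relation.Binary.Reasoning.Setoid

-- Double negation commutes with finite conjunctions, so a case distinction can be made on all
-- coordinates of a vector at once.
¬¬-∀Fin : ∀ {p n} {P : Fin n → Set p} → (∀ i → ¬ ¬ P i) → ¬ ¬ (∀ i → P i)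
¬¬-∀Fin {n = zero}  f k = k λ ()
¬¬-∀Fin {n = suc n} f k =
  f zero λ p → ¬¬-∀Fin (f ∘ suc) λ ps → k λ { zero → p ; (suc i) → ps i }

-- Linear maps between function spaces over one field.

module Linear {c ℓ} (K : Field c ℓ) where
  open Field K hiding (zero)
  open LinAlg K
  open Algebra.Properties.Ring ring public
    using (-1*x≈-x; x[y-z]≈xy-xz; [y-z]x≈yx-zx)
  open Algebra.Properties.AbelianGroup +-abelianGroup public
    using () renaming
      ( x∙y⁻¹≈ε⇒x≈y to x-y≈0⇒x≈y; x≈y⇒x∙y⁻¹≈ε to x≈y⇒x-y≈0; xyx⁻¹≈y to x+y-x≈y
      ; ⁻¹-∙-comm to -x-y≈-[x+y]; ε⁻¹≈ε to -0≈0; ⁻¹-involutive to -‿involutive )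
  open Algebra.Properties.CommutativeSemigroup +-commutativeSemigroup public
    using () renaming (interchange to +-interchange)
  open Algebra.Properties.CommutativeSemigroup *-commutativeSemigroup public
    using () renaming (x∙yz≈y∙xz to x*yz≈y*xz)
  open Relation.Binary.Reasoning.Setoid setoid
  open Inverse using (to; from; strictlyInverseˡ; strictlyInverseʳ)

  private variable
    I J H : Set
    m n d r s a b : ℕ

  infix  4 _≋_
  infixl 6 _⊕_ _⊖_
  infixr 7 _⊙_

  _≋_ : (I → Carrier) → (I → Carrier) → Set ℓ
  x ≋ y = ∀ i → x i ≈ y i

  𝟎 : I → Carrier
  𝟎 _ = 0#

  _⊕_ _⊖_ : (I → Carrier) → (I → Carrier) → I → Carrier
  (x ⊕ y) i = x i + y i
  (x ⊖ y) i = x i - y i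

  _⊙_ : Carrier → (I → Carrier) → I → Carrier
  (a ⊙ x) i = a * x i

  -‿cong₂ : ∀ {a b x y} → a ≈ b → x ≈ y → a - x ≈ b - y
  -‿cong₂ p q = +-cong p (-‿cong q)

  [x-y]+y≈x : ∀ x y → (x - y) + y ≈ x
  [x-y]+y≈x x y = begin
    (x - y) + y   ≈⟨ +-assoc x (- y) y ⟩
    x + (- y + y) ≈⟨ +-congˡ (-‿inverseˡ y) ⟩
    x + 0#        ≈⟨ +-identityʳ x ⟩
    x             ∎

  [x+y]-y≈x : ∀ x y → (x + y) - y ≈ x
  [x+y]-y≈x x y = begin
    (x + y) - y ≈⟨ +-assoc x y (- y) ⟩
    x + (y - y) ≈⟨ +-congˡ (-‿inverseʳ y) ⟩
    x + 0#      ≈⟨ +-identityʳ x ⟩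
    x           ∎

  -‿interchange : ∀ a b x y → (a + b) - (x + y) ≈ (a - x) + (b - y)
  -‿interchange a b x y = begin
    (a + b) - (x + y)     ≈⟨ +-congˡ (-x-y≈-[x+y] x y) ⟨
    (a + b) + (- x - y)   ≈⟨ +-interchange a b (- x) (- y) ⟩
    (a - x) + (b - y)     ∎

  x-0≈x : ∀ x → x - 0# ≈ x
  x-0≈x x = trans (+-congˡ -0≈0) (+-identityʳ x)

  x+y≈0∧y≈0⇒x≈0 : ∀ {x y} → x + y ≈ 0# → y ≈ 0# → x ≈ 0#
  x+y≈0∧y≈0⇒x≈0 {x} {y} p q = trans (sym (+-identityʳ x)) (trans (+-congˡ (sym q)) p)

  *-cancelˡ-0 : ∀ {a x} → ¬ a ≈ 0# → a * x ≈ 0# → x ≈ 0#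
  *-cancelˡ-0 {a} {x} a≉0 ax≈0 with inverse a a≉0
  ... | b , ab≈1 = begin
    x           ≈⟨ *-identityˡ x ⟨
    1# * x      ≈⟨ *-congʳ ab≈1 ⟨
    a * b * x   ≈⟨ *-congʳ (*-comm a b) ⟩
    b * a * x   ≈⟨ *-assoc b a x ⟩
    b * (a * x) ≈⟨ *-congˡ ax≈0 ⟩
    b * 0#      ≈⟨ zeroʳ b ⟩
    0#          ∎

  -- Linear maps are functions with laws rather than matrices, so index sets may be products, sums
  -- or `⊤` without fixing an enumeration.
  record _⊸_ (I J : Set) : Set (c ⊔ ℓ) where
    infixr 5 _⟨$⟩_
    field
      _⟨$⟩_  : (I → Carrier) → J → Carrier
      resp   : ∀ {x y} → x ≋ y → _⟨$⟩_ x ≋ _⟨$⟩_ y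
      ⊕-hom  : ∀ x y → _⟨$⟩_ (x ⊕ y) ≋ _⟨$⟩_ x ⊕ _⟨$⟩_ y
      ⊙-hom  : ∀ a x → _⟨$⟩_ (a ⊙ x) ≋ a ⊙ _⟨$⟩_ x

    𝟎-hom : ∀ {x} → x ≋ 𝟎 → _⟨$⟩_ x ≋ 𝟎
    𝟎-hom {x} x≋0 j = begin
      _⟨$⟩_ x j         ≈⟨ resp (λ i → trans (x≋0 i) (sym (zeroˡ (x i)))) j ⟩
      _⟨$⟩_ (0# ⊙ x) j  ≈⟨ ⊙-hom 0# x j ⟩
      0# * _⟨$⟩_ x j    ≈⟨ zeroˡ _ ⟩
      0#                ∎

    ⊖-hom : ∀ x y → _⟨$⟩_ (x ⊖ y) ≋ _⟨$⟩_ x ⊖ _⟨$⟩_ y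
    ⊖-hom x y j = begin
      _⟨$⟩_ (x ⊖ y) j                   ≈⟨ resp (λ i → +-congˡ (sym (-1*x≈-x (y i)))) j ⟩
      _⟨$⟩_ (x ⊕ (- 1# ⊙ y)) j          ≈⟨ ⊕-hom x _ j ⟩
      _⟨$⟩_ x j + _⟨$⟩_ (- 1# ⊙ y) j    ≈⟨ +-congˡ (⊙-hom (- 1#) y j) ⟩
      _⟨$⟩_ x j + - 1# * _⟨$⟩_ y j      ≈⟨ +-congˡ (-1*x≈-x _) ⟩
      _⟨$⟩_ x j - _⟨$⟩_ y j             ∎

    lincomb-hom : ∀ d cs (b : Fin d → I → Carrier) →
                  _⟨$⟩_ (lincomb d cs b) ≋ lincomb d cs (λ k → _⟨$⟩_ (b k))
    lincomb-hom zero    cs b j = 𝟎-hom (λ _ → refl) j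
    lincomb-hom (suc d) cs b j = begin
      _⟨$⟩_ (lincomb (suc d) cs b) j
        ≈⟨ ⊕-hom (cs zero ⊙ b zero) (lincomb d (cs ∘ suc) (b ∘ suc)) j ⟩
      _⟨$⟩_ (cs zero ⊙ b zero) j + _⟨$⟩_ (lincomb d (cs ∘ suc) (b ∘ suc)) j
        ≈⟨ +-cong (⊙-hom (cs zero) (b zero) j) (lincomb-hom d (cs ∘ suc) (b ∘ suc) j) ⟩
      lincomb (suc d) cs (λ k → _⟨$⟩_ (b k)) j ∎

  open _⊸_ public

  -- Finite sums, linear combinations and the standard basis.

  Σ-cong : ∀ n {f g : Fin n → Carrier} → (∀ i → f i ≈ g i) → Σ[<] n f ≈ Σ[<] n g
  Σ-cong zero    p = refl
  Σ-cong (suc n) p = +-cong (p zero) (Σ-cong n (p ∘ suc))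

  Σ-0 : ∀ n {f : Fin n → Carrier} → (∀ i → f i ≈ 0#) → Σ[<] n f ≈ 0#
  Σ-0 zero    p = refl
  Σ-0 (suc n) p = trans (+-cong (p zero) (Σ-0 n (p ∘ suc))) (+-identityʳ 0#)

  Σ-+ : ∀ n (f g : Fin n → Carrier) → Σ[<] n (λ i → f i + g i) ≈ Σ[<] n f + Σ[<] n g
  Σ-+ zero    f g = sym (+-identityʳ 0#)
  Σ-+ (suc n) f g = trans (+-congˡ (Σ-+ n (f ∘ suc) (g ∘ suc))) (+-interchange _ _ _ _)

  Σ-* : ∀ n a (f : Fin n → Carrier) → Σ[<] n (λ i → a * f i) ≈ a * Σ[<] n f
  Σ-* zero    a f = sym (zeroʳ a)
  Σ-* (suc n) a f = trans (+-congˡ (Σ-* n a (f ∘ suc))) (sym (distribˡ a _ _))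

  span : (Fin d → I → Carrier) → Fin d ⊸ I
  span {d} b = record
    { _⟨$⟩_  = λ cs → lincomb d cs b
    ; resp   = λ p i → Σ-cong d (λ k → *-congʳ (p k))
    ; ⊕-hom  = λ x y i → trans (Σ-cong d (λ k → distribʳ (b k i) (x k) (y k))) (Σ-+ d _ _)
    ; ⊙-hom  = λ a x i → trans (Σ-cong d (λ k → *-assoc a (x k) (b k i))) (Σ-* d a _)
    }

  lincomb-congʳ : ∀ d cs {b b′ : Fin d → I → Carrier} → (∀ k → b k ≋ b′ k) → lincomb d cs b ≋ lincomb d cs b′
  lincomb-congʳ d cs p i = Σ-cong d (λ k → *-congˡ (p k i))

  e : Fin n → Fin n → Carrier
  e zero    zero    = 1#
  e zero    (suc j) = 0#
  e (suc i) zero    = 0#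
  e (suc i) (suc j) = e i j

  expand : ∀ (x : Fin n → Carrier) → x ≋ lincomb n x e
  expand {suc n} x zero = sym (begin
    x zero * 1# + Σ[<] n (λ k → x (suc k) * 0#) ≈⟨ +-cong (*-identityʳ _) (Σ-0 n (λ k → zeroʳ _)) ⟩
    x zero + 0#                                 ≈⟨ +-identityʳ _ ⟩
    x zero                                      ∎)
  expand {suc n} x (suc j) = sym (begin
    x zero * 0# + lincomb n (x ∘ suc) e j ≈⟨ +-cong (zeroʳ _) (sym (expand (x ∘ suc) j)) ⟩
    0# + x (suc j)                        ≈⟨ +-identityˡ _ ⟩
    x (suc j)                             ∎)

  lincomb-e : ∀ (b : Fin d → I → Carrier) k → lincomb d (e k) b ≋ b k
  lincomb-e {suc d} b zero i =
    trans (+-cong (*-identityˡ _) (Σ-0 d (λ k → zeroˡ _))) (+-identityʳ _)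
  lincomb-e {suc d} b (suc k) i =
    trans (+-cong (zeroˡ _) (lincomb-e (b ∘ suc) k i)) (+-identityˡ _)

  as-lincomb : ∀ (f : Fin n ⊸ J) x → (f ⟨$⟩ x) ≋ lincomb n x (λ k → f ⟨$⟩ e k)
  as-lincomb {n} f x j = trans (resp f (expand x) j) (lincomb-hom f n x e j)

  ext : (f g : Fin n ⊸ J) → (∀ k → (f ⟨$⟩ e k) ≋ (g ⟨$⟩ e k)) → ∀ x → (f ⟨$⟩ x) ≋ (g ⟨$⟩ x)
  ext {n} f g p x j = begin
    (f ⟨$⟩ x) j                        ≈⟨ as-lincomb f x j ⟩
    lincomb n x (λ k → f ⟨$⟩ e k) j    ≈⟨ lincomb-congʳ n x p j ⟩
    lincomb n x (λ k → g ⟨$⟩ e k) j    ≈⟨ as-lincomb g x j ⟨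
    (g ⟨$⟩ x) j                        ∎

  -- Constructions of linear maps

  idL : I ⊸ I
  idL = record { _⟨$⟩_ = λ x → x ; resp = λ p → p ; ⊕-hom = λ _ _ _ → refl ; ⊙-hom = λ _ _ _ → refl }

  0L : I ⊸ J
  0L = record
    { _⟨$⟩_ = λ _ → 𝟎 ; resp = λ _ _ → refl
    ; ⊕-hom = λ _ _ _ → sym (+-identityʳ 0#) ; ⊙-hom = λ a _ _ → sym (zeroʳ a) }

  infixr 9 _∘L_
  _∘L_ : J ⊸ H → I ⊸ J → I ⊸ H
  g ∘L f = record
    { _⟨$⟩_ = λ x → g ⟨$⟩ f ⟨$⟩ x
    ; resp  = λ p → resp g (resp f p)
    ; ⊕-hom = λ x y i → trans (resp g (⊕-hom f x y) i) (⊕-hom g _ _ i)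
    ; ⊙-hom = λ a x i → trans (resp g (⊙-hom f a x) i) (⊙-hom g _ _ i)
    }

  infixl 6 _+L_ _-L_
  _+L_ : I ⊸ J → I ⊸ J → I ⊸ J
  f +L g = record
    { _⟨$⟩_ = λ x → (f ⟨$⟩ x) ⊕ (g ⟨$⟩ x)
    ; resp  = λ p i → +-cong (resp f p i) (resp g p i)
    ; ⊕-hom = λ x y i → trans (+-cong (⊕-hom f x y i) (⊕-hom g x y i)) (+-interchange _ _ _ _)
    ; ⊙-hom = λ a x i → trans (+-cong (⊙-hom f a x i) (⊙-hom g a x i)) (sym (distribˡ a _ _))
    }

  scaleL : Carrier → I ⊸ I
  scaleL a = record
    { _⟨$⟩_ = a ⊙_ ; resp = λ p i → *-congˡ (p i)
    ; ⊕-hom = λ x y i → distribˡ a (x i) (y i) ; ⊙-hom = λ b x i → x*yz≈y*xz a b (x i) }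

  _-L_ : I ⊸ J → I ⊸ J → I ⊸ J
  f -L g = record
    { _⟨$⟩_ = λ x → (f ⟨$⟩ x) ⊖ (g ⟨$⟩ x)
    ; resp  = λ p i → -‿cong₂ (resp f p i) (resp g p i)
    ; ⊕-hom = λ x y i → trans (-‿cong₂ (⊕-hom f x y i) (⊕-hom g x y i)) (-‿interchange _ _ _ _)
    ; ⊙-hom = λ a x i → trans (-‿cong₂ (⊙-hom f a x i) (⊙-hom g a x i)) (sym (x[y-z]≈xy-xz a _ _))
    }

  pull : (J → I) → I ⊸ J
  pull g = record
    { _⟨$⟩_ = λ x → x ∘ g ; resp = λ p → p ∘ g ; ⊕-hom = λ _ _ _ → refl ; ⊙-hom = λ _ _ _ → refl }

  line : (I → Carrier) → ⊤ ⊸ I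
  line v = record
    { _⟨$⟩_ = λ a i → a tt * v i
    ; resp  = λ p i → *-congʳ (p tt)
    ; ⊕-hom = λ x y i → distribʳ (v i) (x tt) (y tt)
    ; ⊙-hom = λ a x i → *-assoc a (x tt) (v i) }

  tuple : (H → I ⊸ J) → I ⊸ (J × H)
  tuple f = record
    { _⟨$⟩_ = λ x (j , l) → (f l ⟨$⟩ x) j
    ; resp  = λ p (j , l) → resp (f l) p j
    ; ⊕-hom = λ x y (j , l) → ⊕-hom (f l) x y j
    ; ⊙-hom = λ a x (j , l) → ⊙-hom (f l) a x j }

  pair : I ⊸ J → I ⊸ H → I ⊸ (J ⊎ H)
  pair f g = record
    { _⟨$⟩_ = λ x → Sum.[ f ⟨$⟩ x , g ⟨$⟩ x ]
    ; resp  = λ p → Sum.[ resp f p , resp g p ]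
    ; ⊕-hom = λ x y → Sum.[ ⊕-hom f x y , ⊕-hom g x y ]
    ; ⊙-hom = λ a x → Sum.[ ⊙-hom f a x , ⊙-hom g a x ] }

  copair : I ⊸ H → J ⊸ H → (I ⊎ J) ⊸ H
  copair f g = f ∘L pull inj₁ +L g ∘L pull inj₂

  cons : I ⊸ ⊤ → I ⊸ Fin n → I ⊸ Fin (suc n)
  cons f g = pull unshift ∘L pair f g
    where
    unshift : Fin (suc n) → ⊤ ⊎ Fin n
    unshift zero    = inj₁ tt
    unshift (suc i) = inj₂ i

  head : Fin (suc n) ⊸ ⊤
  head = pull (λ _ → zero)

  tail : Fin (suc n) ⊸ Fin n
  tail = pull suc

  -- Pivots, and comparison of dimensions through injective maps.

  zero-or-pivot : (x : Fin n → Carrier) → ¬ ¬ ((∃ λ j → ¬ x j ≈ 0#) ⊎ x ≋ 𝟎)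
  zero-or-pivot x k =
    ¬¬-∀Fin (λ j x≉0 → k (inj₁ (j , x≉0))) (λ x≋0 → k (inj₂ x≋0))

  -- The conclusion is doubly negated because in `krylov-independent` the vanishing of a coefficient
  -- is only obtained by contradiction; this weak form still bounds dimensions.
  WeaklyInjective : I ⊸ J → Set (c ⊔ ℓ)
  WeaklyInjective f = ∀ x → (f ⟨$⟩ x) ≋ 𝟎 → ∀ i → ¬ ¬ x i ≈ 0#

  insert0 : Fin (suc n) → Fin n ⊸ Fin (suc n)
  insert0 {n} j = record { _⟨$⟩_ = ins ; resp = ins-resp ; ⊕-hom = ins-⊕ ; ⊙-hom = ins-⊙ }
    where
    ins : (Fin n → Carrier) → Fin (suc n) → Carrier
    ins x i with j Fin.≟ i
    ... | yes _  = 0#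
    ... | no j≢i = x (punchOut j≢i)
    ins-resp : ∀ {x y} → x ≋ y → ins x ≋ ins y
    ins-resp p i with j Fin.≟ i
    ... | yes _  = refl
    ... | no j≢i = p (punchOut j≢i)
    ins-⊕ : ∀ x y → ins (x ⊕ y) ≋ ins x ⊕ ins y
    ins-⊕ x y i with j Fin.≟ i
    ... | yes _  = sym (+-identityʳ 0#)
    ... | no j≢i = refl
    ins-⊙ : ∀ b x → ins (b ⊙ x) ≋ b ⊙ ins x
    ins-⊙ b x i with j Fin.≟ i
    ... | yes _  = sym (zeroʳ b)
    ... | no j≢i = refl

  insert0-punchIn : ∀ (j : Fin (suc n)) x i → (insert0 j ⟨$⟩ x) (punchIn j i) ≈ x i
  insert0-punchIn j x i with j Fin.≟ punchIn j i
  ... | yes p  = contradiction (≡.sym p) (Finₚ.punchInᵢ≢i j i)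
  ... | no j≢i = reflexive (≡.cong x (≡.trans (Finₚ.punchOut-cong j ≡.refl) (Finₚ.punchOut-punchIn j)))

  e-punchIn : ∀ (j : Fin (suc n)) i → e j (punchIn j i) ≈ 0#
  e-punchIn zero    i       = refl
  e-punchIn {suc n} (suc j) zero    = refl
  e-punchIn {suc n} (suc j) (suc i) = e-punchIn j i

  injective⇒≤ : (f : Fin m ⊸ Fin n) → WeaklyInjective f → m ℕ.≤ n
  injective⇒≤ {zero}          f inj = z≤n
  injective⇒≤ {suc m} {zero}  f inj = contradiction (λ 1≈0 → 0≉1 (sym 1≈0)) (inj (e zero) (λ ()) zero)
  injective⇒≤ {suc m} {suc n} f inj =
    decidable-stable (suc m ℕ.≤? suc n) λ m≰n →
      zero-or-pivot (λ j → (f ⟨$⟩ e j) zero) λ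
        { (inj₂ φ≋0)       → m≰n (ℕₚ.m≤n⇒m≤1+n (injective⇒≤ (tail ∘L f) λ x p → inj x λ
            { zero    → ext (head ∘L f) 0L (λ k _ → φ≋0 k) x tt
            ; (suc i) → p i }))
        ; (inj₁ (j , φj≉0)) → m≰n (s≤s (eliminate j φj≉0)) }
    where
    eliminate : ∀ j → ¬ (f ⟨$⟩ e j) zero ≈ 0# → m ℕ.≤ n
    eliminate j φj≉0 with inverse _ φj≉0
    ... | t , φj*t≈1 = injective⇒≤ (tail ∘L f ∘L E) λ x p i k →
          inj (E ⟨$⟩ x) (λ { zero → φE≈0 x ; (suc i) → p i }) (punchIn j i) (k ∘ trans (sym (E-punchIn x i)))
      where
      φ : Fin (suc m) ⊸ ⊤
      φ = head ∘L f
      -- `E` parametrizes the kernel of `φ` by the coordinates other than `j`; coordinate `j` is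
      -- solved for, with `t` the inverse of the pivot.
      E : Fin m ⊸ Fin (suc m)
      E = insert0 j -L line (t ⊙ e j) ∘L φ ∘L insert0 j
      E-punchIn : ∀ x i → (E ⟨$⟩ x) (punchIn j i) ≈ x i
      E-punchIn x i = begin
        (E ⟨$⟩ x) (punchIn j i) ≈⟨ -‿cong₂ (insert0-punchIn j x i) (*-congˡ (*-congˡ (e-punchIn j i))) ⟩
        x i - _ * (t * 0#)      ≈⟨ -‿cong₂ refl (trans (*-congˡ (zeroʳ t)) (zeroʳ _)) ⟩
        x i - 0#                ≈⟨ x-0≈x (x i) ⟩
        x i                     ∎
      φE≈0 : ∀ x → (φ ⟨$⟩ E ⟨$⟩ x) tt ≈ 0#
      φE≈0 x = let y = insert0 j ⟨$⟩ x ; a = (φ ⟨$⟩ y) tt in trans (⊖-hom φ y _ tt) (x≈y⇒x-y≈0 (begin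
        a                              ≈⟨ *-identityʳ a ⟨
        a * 1#                         ≈⟨ *-congˡ φj*t≈1 ⟨
        a * ((φ ⟨$⟩ e j) tt * t)       ≈⟨ *-congˡ (*-comm _ t) ⟩
        a * (t * (φ ⟨$⟩ e j) tt)       ≈⟨ *-congˡ (⊙-hom φ t (e j) tt) ⟨
        a * (φ ⟨$⟩ t ⊙ e j) tt         ≈⟨ ⊙-hom φ a (t ⊙ e j) tt ⟨
        (φ ⟨$⟩ a ⊙ t ⊙ e j) tt         ∎))

  injective⇒≤′ : Fin m ↔ I → Fin n ↔ J → (f : I ⊸ J) → WeaklyInjective f → m ℕ.≤ n
  injective⇒≤′ {m} {I} {n} {J} μ ν f inj = injective⇒≤ (pull (to ν) ∘L f ∘L pull (from μ)) λ x p i k →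
    inj (x ∘ from μ) (λ j → trans (reflexive (≡.cong (f ⟨$⟩ x ∘ from μ) (≡.sym (strictlyInverseˡ ν j)))) (p (from ν j)))
      (to μ i) (k ∘ trans (reflexive (≡.cong x (≡.sym (strictlyInverseʳ μ i)))))

  -- Rank factorizations, kernels and cokernels.

  infix 4 _≗_
  _≗_ : I ⊸ J → I ⊸ J → Set (c ⊔ ℓ)
  f ≗ g = ∀ x → (f ⟨$⟩ x) ≋ (g ⟨$⟩ x)

  leftInverse⇒injective : (f : I ⊸ J) (g : J ⊸ I) → g ∘L f ≗ idL → ∀ {x} → (f ⟨$⟩ x) ≋ 𝟎 → x ≋ 𝟎
  leftInverse⇒injective f g gf≗id {x} fx≋0 i = trans (sym (gf≗id x i)) (𝟎-hom g fx≋0 i)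

  -- The one-sided inverses `L` and `S` express by equations that `C` is injective and `R`
  -- surjective. Moreover `S ∘L L` is a generalized inverse of `f`.
  record RankFactorization {n m} (f : Fin n ⊸ Fin m) : Set (c ⊔ ℓ) where
    field
      rank : ℕ
      C    : Fin rank ⊸ Fin m
      R    : Fin n ⊸ Fin rank
      L    : Fin m ⊸ Fin rank
      S    : Fin rank ⊸ Fin n
      CR≗f  : C ∘L R ≗ f
      LC≗id : L ∘L C ≗ idL
      RS≗id : R ∘L S ≗ idL

  -- Row by row: the first coordinate φ of f either factors through R already,
  -- or its part φ′ vanishing on im S becomes a new row of R.
  rankFactorization : (f : Fin n ⊸ Fin m) → ¬ ¬ RankFactorization f
  rankFactorization {n} {zero} f k = k record
    { rank = 0 ; C = 0L ; R = 0L ; L = 0L ; S = 0L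
    ; CR≗f = λ _ () ; LC≗id = λ _ () ; RS≗id = λ _ () }
  rankFactorization {n} {suc m} f k = rankFactorization (tail ∘L f) λ rf →
    zero-or-pivot (λ j → (φ′ rf ⟨$⟩ e j) tt) λ
      { (inj₂ φ′≋0)         → k (dependent rf φ′≋0)
      ; (inj₁ (j , φ′j≉0))  → k (independent rf j φ′j≉0) }
    where
    φ : Fin n ⊸ ⊤
    φ = head ∘L f
    φ′ : RankFactorization (tail ∘L f) → Fin n ⊸ ⊤
    φ′ rf = φ -L φ ∘L S ∘L R where open RankFactorization rf

    dependent : (rf : RankFactorization (tail ∘L f)) → (∀ j → (φ′ rf ⟨$⟩ e j) tt ≈ 0#) → RankFactorization f
    dependent rf φ′≋0 = record
      { rank = rank ; C = cons (φ ∘L S) C ; R = R ; L = L ∘L tail ; S = S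
      ; CR≗f  = λ x → λ { zero    → sym (x-y≈0⇒x≈y _ _ (ext (φ′ rf) 0L (λ j _ → φ′≋0 j) x tt))
                        ; (suc i) → CR≗f x i }
      ; LC≗id = LC≗id
      ; RS≗id = RS≗id }
      where open RankFactorization rf

    independent : (rf : RankFactorization (tail ∘L f)) → ∀ j → ¬ (φ′ rf ⟨$⟩ e j) tt ≈ 0# → RankFactorization f
    independent rf j φ′j≉0 with inverse _ φ′j≉0
    ... | t , φ′j*t≈1 = record
      { rank = suc rank
      ; C = cons (head +L φ ∘L S ∘L tail) (C ∘L tail)
      ; R = cons (φ′ rf) R
      -- The head of `C ⟨$⟩ y` is `y zero` plus `φ ∘L S` of the remaining coordinates; the old `L`
      -- recovers these, so the surplus can be subtracted.
      ; L = cons (head -L φ ∘L S ∘L L ∘L tail) (L ∘L tail)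
      ; S = line v ∘L head +L S ∘L tail
      ; CR≗f  = λ x → λ { zero → [x-y]+y≈x _ _ ; (suc i) → CR≗f x i }
      ; LC≗id = λ y → λ
          { zero    → trans (-‿cong₂ refl (resp (φ ∘L S) (LC≗id (y ∘ suc)) tt)) ([x+y]-y≈x _ _)
          ; (suc i) → LC≗id (y ∘ suc) i }
      ; RS≗id = λ y → λ
          { zero    → begin
              (φ′ rf ⟨$⟩ (y zero ⊙ v) ⊕ (S ⟨$⟩ y ∘ suc)) tt
                ≈⟨ ⊕-hom (φ′ rf) (y zero ⊙ v) _ tt ⟩
              (φ′ rf ⟨$⟩ y zero ⊙ v) tt + (φ′ rf ⟨$⟩ S ⟨$⟩ y ∘ suc) tt
                ≈⟨ +-cong (⊙-hom (φ′ rf) (y zero) v tt) (φ′S≈0 (y ∘ suc)) ⟩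
              y zero * (φ′ rf ⟨$⟩ v) tt + 0#
                ≈⟨ +-identityʳ _ ⟩
              y zero * (φ′ rf ⟨$⟩ v) tt
                ≈⟨ *-congˡ φ′v≈1 ⟩
              y zero * 1#
                ≈⟨ *-identityʳ _ ⟩
              y zero ∎
          ; (suc i) → begin
              (R ⟨$⟩ (y zero ⊙ v) ⊕ (S ⟨$⟩ y ∘ suc)) i
                ≈⟨ ⊕-hom R (y zero ⊙ v) _ i ⟩
              (R ⟨$⟩ y zero ⊙ v) i + (R ⟨$⟩ S ⟨$⟩ y ∘ suc) i
                ≈⟨ +-cong (trans (⊙-hom R (y zero) v i) (trans (*-congˡ (Rv≋0 i)) (zeroʳ _))) (RS≗id (y ∘ suc) i) ⟩
              0# + y (suc i)
                ≈⟨ +-identityˡ _ ⟩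
              y (suc i) ∎ } }
      where
      open RankFactorization rf
      -- `w` is the part of `e j` in the kernel of `R`. Since `φ′` vanishes on the image of `S`, it
      -- takes the same value on `w` as on `e j`, and `t` normalizes that value to 1.
      w v : Fin n → Carrier
      w = e j ⊖ (S ⟨$⟩ R ⟨$⟩ e j)
      v = t ⊙ w
      φ′S≈0 : ∀ y → (φ′ rf ⟨$⟩ S ⟨$⟩ y) tt ≈ 0#
      φ′S≈0 y = x≈y⇒x-y≈0 (sym (resp (φ ∘L S) (RS≗id y) tt))
      φ′v≈1 : (φ′ rf ⟨$⟩ v) tt ≈ 1#
      φ′v≈1 = begin
        (φ′ rf ⟨$⟩ t ⊙ w) tt ≈⟨ ⊙-hom (φ′ rf) t w tt ⟩
        t * (φ′ rf ⟨$⟩ w) tt ≈⟨ *-congˡ (⊖-hom (φ′ rf) (e j) _ tt) ⟩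
        t * ((φ′ rf ⟨$⟩ e j) tt - (φ′ rf ⟨$⟩ S ⟨$⟩ R ⟨$⟩ e j) tt)
          ≈⟨ *-congˡ (trans (-‿cong₂ refl (φ′S≈0 _)) (x-0≈x _)) ⟩
        t * (φ′ rf ⟨$⟩ e j) tt ≈⟨ *-comm t _ ⟩
        (φ′ rf ⟨$⟩ e j) tt * t ≈⟨ φ′j*t≈1 ⟩
        1# ∎
      Rv≋0 : (R ⟨$⟩ v) ≋ 𝟎
      Rv≋0 i = trans (⊙-hom R t w i) (trans (*-congˡ (trans (⊖-hom R (e j) _ i) (x≈y⇒x-y≈0 (sym (RS≗id _ i))))) (zeroʳ t))

  -- The splitting of the space into the image of `S` and the kernel of `R`: `U` includes the
  -- kernel, and `T` projects onto it along the image of `S`.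
  record Complement {n m} (R : Fin n ⊸ Fin m) (S : Fin m ⊸ Fin n) : Set (c ⊔ ℓ) where
    field
      corank : ℕ
      U      : Fin corank ⊸ Fin n
      T      : Fin n ⊸ Fin corank
      SR+UT≗id : S ∘L R +L U ∘L T ≗ idL
      TU≗id    : T ∘L U ≗ idL
      RU≗0     : R ∘L U ≗ 0L
      TS≗0     : T ∘L S ≗ 0L
      dim-sum  : m ℕ.+ corank ≡ n

  -- `S ∘L R` is idempotent with the same kernel as `R`, so a rank factorization of the
  -- complementary projection yields `U` and `T`. The two inequalities behind `dim-sum` come from
  -- the injections `copair S U` and `pair R T`.
  complement : (R : Fin n ⊸ Fin m) (S : Fin m ⊸ Fin n) → R ∘L S ≗ idL → ¬ ¬ Complement R S
  complement {n} {m} R S RS≗id k = rankFactorization (idL -L S ∘L R) λ rf →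
    let open RankFactorization rf renaming (C to U; R to T; L to L′; S to S′; CR≗f to UT≗id-SR; LC≗id to L′U≗id; RS≗id to TS′≗id)
        RU≗0 : R ∘L U ≗ 0L
        RU≗0 y i = begin
          (R ⟨$⟩ U ⟨$⟩ y) i                 ≈⟨ resp (R ∘L U) (TS′≗id y) i ⟨
          (R ⟨$⟩ U ⟨$⟩ T ⟨$⟩ S′ ⟨$⟩ y) i     ≈⟨ resp R (UT≗id-SR _) i ⟩
          (R ⟨$⟩ (S′ ⟨$⟩ y) ⊖ (S ⟨$⟩ R ⟨$⟩ S′ ⟨$⟩ y)) i ≈⟨ ⊖-hom R _ _ i ⟩
          (R ⟨$⟩ S′ ⟨$⟩ y) i - (R ⟨$⟩ S ⟨$⟩ R ⟨$⟩ S′ ⟨$⟩ y) i ≈⟨ x≈y⇒x-y≈0 (sym (RS≗id _ i)) ⟩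
          0# ∎
        TS≗0 : T ∘L S ≗ 0L
        TS≗0 y = leftInverse⇒injective U L′ L′U≗id λ i →
          trans (UT≗id-SR _ i) (x≈y⇒x-y≈0 (sym (resp S (RS≗id y) i)))
        id≗ : S ∘L R +L U ∘L T ≗ idL
        id≗ x i = trans (+-congˡ (UT≗id-SR x i)) (trans (+-comm _ _) ([x-y]+y≈x _ _))
        TU≗id : T ∘L U ≗ idL
        TU≗id y i = begin
          (T ⟨$⟩ U ⟨$⟩ y) i                        ≈⟨ L′U≗id _ i ⟨
          (L′ ⟨$⟩ U ⟨$⟩ T ⟨$⟩ U ⟨$⟩ y) i            ≈⟨ resp L′ (UT≗id-SR _) i ⟩
          (L′ ⟨$⟩ (U ⟨$⟩ y) ⊖ (S ⟨$⟩ R ⟨$⟩ U ⟨$⟩ y)) i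
            ≈⟨ resp L′ (λ i → trans (-‿cong₂ refl (𝟎-hom S (RU≗0 y) i)) (x-0≈x _)) i ⟩
          (L′ ⟨$⟩ U ⟨$⟩ y) i                       ≈⟨ L′U≗id y i ⟩
          y i ∎
        m+k≤n : m ℕ.+ rank ℕ.≤ n
        m+k≤n = injective⇒≤′ Finₚ.+↔⊎ (↔-refl) (copair S U) λ x p →
          let S₁≋0 : (x ∘ inj₁) ≋ 𝟎
              S₁≋0 i = begin
                x (inj₁ i) ≈⟨ RS≗id _ i ⟨
                (R ⟨$⟩ S ⟨$⟩ x ∘ inj₁) i ≈⟨ +-identityʳ _ ⟨
                (R ⟨$⟩ S ⟨$⟩ x ∘ inj₁) i + 0# ≈⟨ +-congˡ (RU≗0 _ i) ⟨
                (R ⟨$⟩ S ⟨$⟩ x ∘ inj₁) i + (R ⟨$⟩ U ⟨$⟩ x ∘ inj₂) i ≈⟨ ⊕-hom R _ _ i ⟨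
                (R ⟨$⟩ copair S U ⟨$⟩ x) i ≈⟨ 𝟎-hom R p i ⟩
                0# ∎
          in λ { (inj₁ i) k → k (S₁≋0 i)
               ; (inj₂ i) k → k (leftInverse⇒injective U T TU≗id (λ j →
                   trans (sym (+-identityˡ _)) (trans (+-congʳ (sym (𝟎-hom S S₁≋0 j))) (p j))) i) }
        n≤m+k : n ℕ.≤ m ℕ.+ rank
        n≤m+k = injective⇒≤′ (↔-refl) Finₚ.+↔⊎ (pair R T) λ x p i k → k (begin
          x i ≈⟨ id≗ x i ⟨
          (S ⟨$⟩ R ⟨$⟩ x) i + (U ⟨$⟩ T ⟨$⟩ x) i ≈⟨ +-cong (𝟎-hom S (p ∘ inj₁) i) (𝟎-hom U (p ∘ inj₂) i) ⟩
          0# + 0# ≈⟨ +-identityʳ 0# ⟩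
          0# ∎)
    in k record
      { corank = rank ; U = U ; T = T ; SR+UT≗id = id≗ ; TU≗id = TU≗id ; RU≗0 = RU≗0 ; TS≗0 = TS≗0
      ; dim-sum = ℕₚ.≤-antisym m+k≤n n≤m+k }

  -- The complement for `R` and `S` is the kernel of `f`. For `L` and `C` it is a cokernel: `W`
  -- vanishes on the image of `f`, its rows span the left kernel, and `V` is a section of it.
  record Decomposition {n m} (f : Fin n ⊸ Fin m) : Set (c ⊔ ℓ) where
    field
      rankFact : RankFactorization f
    open RankFactorization rankFact public
    field
      kernel   : Complement R S
      cokernel : Complement L C
    open Complement kernel public
    open Complement cokernel public renaming
      ( corank to corank′; U to V; T to W; SR+UT≗id to CL+VW≗id; TU≗id to WV≗id
      ; RU≗0 to LV≗0; TS≗0 to WC≗0; dim-sum to dim-sum′ )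

    fU≗0 : f ∘L U ≗ 0L
    fU≗0 x i = trans (sym (CR≗f _ i)) (𝟎-hom C (RU≗0 x) i)

    Wf≗0 : W ∘L f ≗ 0L
    Wf≗0 x i = trans (sym (resp W (CR≗f x) i)) (WC≗0 _ i)

    ker⇒R≋0 : ∀ {x} → (f ⟨$⟩ x) ≋ 𝟎 → (R ⟨$⟩ x) ≋ 𝟎
    ker⇒R≋0 p = leftInverse⇒injective C L LC≗id (λ i → trans (CR≗f _ i) (p i))

    ker⇒UT : ∀ {x} → (f ⟨$⟩ x) ≋ 𝟎 → (U ⟨$⟩ T ⟨$⟩ x) ≋ x
    ker⇒UT {x} p i = begin
      (U ⟨$⟩ T ⟨$⟩ x) i                      ≈⟨ +-identityˡ _ ⟨
      0# + (U ⟨$⟩ T ⟨$⟩ x) i                 ≈⟨ +-congʳ (𝟎-hom S (ker⇒R≋0 p) i) ⟨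
      (S ⟨$⟩ R ⟨$⟩ x) i + (U ⟨$⟩ T ⟨$⟩ x) i  ≈⟨ SR+UT≗id x i ⟩
      x i                                    ∎

    C≗fS : C ≗ f ∘L S
    C≗fS x i = trans (sym (resp C (RS≗id x) i)) (CR≗f _ i)

  decomposition : (f : Fin n ⊸ Fin m) → ¬ ¬ Decomposition f
  decomposition f k = rankFactorization f λ rf → let open RankFactorization rf in
    complement R S RS≗id λ ker → complement L C LC≗id λ coker →
    k record { rankFact = rf ; kernel = ker ; cokernel = coker }

  corank≡corank′ : {f : Fin n ⊸ Fin n} (D : Decomposition f) → Decomposition.corank D ≡ Decomposition.corank′ D
  corank≡corank′ D = ℕₚ.+-cancelˡ-≡ rank _ _ (≡.trans dim-sum (≡.sym dim-sum′)) where open Decomposition D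

  -- Dimensions of subspaces

  -- Coordinates are required only at the vectors `e k` and are then extended linearly, so no chosen
  -- system of coordinates has to be proved linear.
  factor : (f : Fin m ⊸ I) (b : Fin d → I → Carrier) →
           (∀ k → ∃ λ cs → (f ⟨$⟩ e k) ≋ lincomb d cs b) → Σ (Fin m ⊸ Fin d) λ Z → f ≗ span b ∘L Z
  factor f b h = Z , ext f (span b ∘L Z) λ k i →
    trans (proj₂ (h k) i) (sym (resp (span b) (lincomb-e (proj₁ ∘ h) k) i))
    where
    Z : _ ⊸ _
    Z = span (proj₁ ∘ h)

  embedding⇒≤dim : ∀ {p} {P : (I → Carrier) → Set p} → IsDim P d → Fin m ↔ J →
                   (f : J ⊸ I) → (∀ x → P (f ⟨$⟩ x)) → WeaklyInjective f → m ℕ.≤ d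
  embedding⇒≤dim {m = m} (b , _ , _ , spans) μ f Pf inj =
    let g = f ∘L pull (from μ)
        Z , g≗bZ = factor g b (λ k → spans _ (Pf _))
    in injective⇒≤ Z λ x p i k →
      inj (x ∘ from μ) (λ j → trans (g≗bZ x j) (𝟎-hom (span b) p j)) (to μ i)
        (k ∘ trans (reflexive (≡.cong x (≡.sym (strictlyInverseʳ μ i)))))

  lincomb-𝟎 : ∀ d cs {b : Fin d → I → Carrier} → (∀ k → b k ≋ 𝟎) → lincomb d cs b ≋ 𝟎
  lincomb-𝟎 d cs p i = Σ-0 d (λ k → trans (*-congˡ (p k i)) (zeroʳ _))

  ker-lincomb : (Φ : I ⊸ J) {b : Fin d → I → Carrier} → (∀ k → (Φ ⟨$⟩ b k) ≋ 𝟎) →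
                ∀ cs → (Φ ⟨$⟩ lincomb d cs b) ≋ 𝟎
  ker-lincomb {d = d} Φ p cs i = trans (lincomb-hom Φ d cs _ i) (lincomb-𝟎 d cs p i)

  -- `IsDim` does not say that `P` is closed under linear combinations. The kernel of `Φ` stands in
  -- for that: it contains `P`, hence every combination of the basis, and `g` is injective on it.
  dim≤ : ∀ {p} {P : (I → Carrier) → Set p} → IsDim P d → Fin n ↔ H →
         (Φ : I ⊸ J) → (∀ v → P v → (Φ ⟨$⟩ v) ≋ 𝟎) →
         (g : I ⊸ H) → (∀ v → (Φ ⟨$⟩ v) ≋ 𝟎 → (g ⟨$⟩ v) ≋ 𝟎 → v ≋ 𝟎) → d ℕ.≤ n
  dim≤ (b , Pb , indep , _) ν Φ P⇒ker g inj =
    injective⇒≤′ ↔-refl ν (g ∘L span b) λ cs p k ¬q →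
      ¬q (indep cs (inj _ (ker-lincomb Φ (λ k → P⇒ker _ (Pb k)) cs) p) k)

  -- Matrices and the commutant

  mulL : ∀ {r s} → Mat r s → Fin s ⊸ Fin r
  mulL {r} {s} M = record
    { _⟨$⟩_ = M ·_
    ; resp  = λ p i → Σ-cong s (λ j → *-congˡ (p j))
    ; ⊕-hom = λ x y i → trans (Σ-cong s (λ j → distribˡ _ _ _)) (Σ-+ s _ _)
    ; ⊙-hom = λ a x i → trans (Σ-cong s (λ j → x*yz≈y*xz _ a _)) (Σ-* s a _) }

  mulL-e : ∀ {r s} (M : Mat r s) j i → (M · e j) i ≈ M i j
  mulL-e {s = s} M j i = trans (Σ-cong s (λ k → *-comm _ _)) (lincomb-e (λ k i → M i k) j i)

  apply : (Fin r × Fin s → Carrier) → Fin s ⊸ Fin r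
  apply X = mulL (λ i k → X (i , k))

  apply-e : ∀ (X : Fin r × Fin s → Carrier) j i → (apply X ⟨$⟩ e j) i ≈ X (i , j)
  apply-e X = mulL-e (λ i k → X (i , k))

  apply≗0⇒≋𝟎 : (X : Fin r × Fin s → Carrier) → apply X ≗ 0L → X ≋ 𝟎
  apply≗0⇒≋𝟎 X p (i , j) = trans (sym (apply-e X j i)) (p (e j) i)

  -- The same product as in `apply`, now regarded as linear in the matrix.
  at : (Fin s → Carrier) → (Fin r × Fin s) ⊸ Fin r
  at {s} v = record
    { _⟨$⟩_ = λ X → apply X ⟨$⟩ v
    ; resp  = λ p i → Σ-cong s (λ j → *-congʳ (p (i , j)))
    ; ⊕-hom = λ X Y i → trans (Σ-cong s (λ j → distribʳ _ _ _)) (Σ-+ s _ _)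
    ; ⊙-hom = λ a X i → trans (Σ-cong s (λ j → *-assoc a _ _)) (Σ-* s a _) }

  sandwich : Fin a ⊸ Fin r → Fin s ⊸ Fin b → (Fin a × Fin b) ⊸ (Fin r × Fin s)
  sandwich U W = tuple (λ j → U ∘L at (W ⟨$⟩ e j))

  apply-sandwich : (U : Fin a ⊸ Fin r) (W : Fin s ⊸ Fin b) (X : Fin a × Fin b → Carrier) →
                   apply (sandwich U W ⟨$⟩ X) ≗ U ∘L apply X ∘L W
  apply-sandwich U W X = ext (apply (sandwich U W ⟨$⟩ X)) (U ∘L apply X ∘L W) (apply-e (sandwich U W ⟨$⟩ X))

  sandwich-injective : (U : Fin a ⊸ Fin r) (T : Fin r ⊸ Fin a) → T ∘L U ≗ idL →
                       (W : Fin s ⊸ Fin b) (V : Fin b ⊸ Fin s) → W ∘L V ≗ idL →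
                       ∀ X → (sandwich U W ⟨$⟩ X) ≋ 𝟎 → X ≋ 𝟎
  sandwich-injective U T TU≗id W V WV≗id X p = apply≗0⇒≋𝟎 X λ v →
    leftInverse⇒injective U T TU≗id λ i → begin
      (U ⟨$⟩ apply X ⟨$⟩ v) i                ≈⟨ resp (U ∘L apply X) (WV≗id v) i ⟨
      (U ⟨$⟩ apply X ⟨$⟩ W ⟨$⟩ V ⟨$⟩ v) i    ≈⟨ apply-sandwich U W X (V ⟨$⟩ v) i ⟨
      (apply (sandwich U W ⟨$⟩ X) ⟨$⟩ V ⟨$⟩ v) i ≈⟨ 𝟎-hom (at (V ⟨$⟩ v)) p i ⟩
      0#                                     ∎

  -- The map X ↦ AX - XB, given by columns. Its kernel is the commutant, which thus becomes
  -- accessible to `dim≤` and to base change.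
  commutator : Mat r r → Mat s s → (Fin r × Fin s) ⊸ (Fin r × Fin s)
  commutator A B = tuple (λ j → mulL A ∘L at (e j) -L at (mulL B ⟨$⟩ e j))

  module _ (A : Mat r r) (B : Mat s s) where

    commutant⇒intertwines : ∀ X → Commutant A B X → mulL A ∘L apply X ≗ apply X ∘L mulL B
    commutant⇒intertwines X AX≈XB = ext (mulL A ∘L apply X) (apply X ∘L mulL B) λ j i → begin
      (A · (apply X ⟨$⟩ e j)) i         ≈⟨ resp (mulL A) (apply-e X j) i ⟩
      (A · (λ k → X (k , j))) i         ≈⟨ AX≈XB i j ⟩
      (apply X ⟨$⟩ (λ k → B k j)) i     ≈⟨ resp (apply X) (mulL-e B j) i ⟨
      (apply X ⟨$⟩ mulL B ⟨$⟩ e j) i    ∎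

    intertwines⇒commutant : ∀ X → mulL A ∘L apply X ≗ apply X ∘L mulL B → Commutant A B X
    intertwines⇒commutant X AX≗XB i j = begin
      (A · (λ k → X (k , j))) i         ≈⟨ resp (mulL A) (apply-e X j) i ⟨
      (A · (apply X ⟨$⟩ e j)) i         ≈⟨ AX≗XB (e j) i ⟩
      (apply X ⟨$⟩ mulL B ⟨$⟩ e j) i    ≈⟨ resp (apply X) (mulL-e B j) i ⟩
      (apply X ⟨$⟩ (λ k → B k j)) i     ∎

    commutant⇒ker : ∀ X → Commutant A B X → (commutator A B ⟨$⟩ X) ≋ 𝟎
    commutant⇒ker X p (i , j) = x≈y⇒x-y≈0 (commutant⇒intertwines X p (e j) i)

    ker⇒intertwines : ∀ X → (commutator A B ⟨$⟩ X) ≋ 𝟎 → mulL A ∘L apply X ≗ apply X ∘L mulL B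
    ker⇒intertwines X p = ext (mulL A ∘L apply X) (apply X ∘L mulL B) λ j i → x-y≈0⇒x≈y _ _ (p (i , j))

    ker⇒commutant : ∀ X → (commutator A B ⟨$⟩ X) ≋ 𝟎 → Commutant A B X
    ker⇒commutant X p = intertwines⇒commutant X (ker⇒intertwines X p)

    -- Both sides equal α U X W. The value 0 of `α` serves the rank bound, the other values the
    -- eigenvalue bound.
    sandwich-intertwines : ∀ α (U : Fin a ⊸ Fin r) (W : Fin s ⊸ Fin b) →
      mulL A ∘L U ≗ scaleL α ∘L U → W ∘L mulL B ≗ scaleL α ∘L W →
      ∀ X → mulL A ∘L apply (sandwich U W ⟨$⟩ X) ≗ apply (sandwich U W ⟨$⟩ X) ∘L mulL B
    sandwich-intertwines α U W AU≗αU WB≗αW X v i = begin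
      (mulL A ⟨$⟩ apply Y ⟨$⟩ v) i             ≈⟨ resp (mulL A) (apply-sandwich U W X v) i ⟩
      (mulL A ⟨$⟩ U ⟨$⟩ apply X ⟨$⟩ W ⟨$⟩ v) i ≈⟨ AU≗αU _ i ⟩
      α * (U ⟨$⟩ apply X ⟨$⟩ W ⟨$⟩ v) i        ≈⟨ ⊙-hom (U ∘L apply X) α _ i ⟨
      (U ⟨$⟩ apply X ⟨$⟩ α ⊙ (W ⟨$⟩ v)) i      ≈⟨ resp (U ∘L apply X) (WB≗αW v) i ⟨
      (U ⟨$⟩ apply X ⟨$⟩ W ⟨$⟩ mulL B ⟨$⟩ v) i ≈⟨ apply-sandwich U W X _ i ⟨
      (apply Y ⟨$⟩ mulL B ⟨$⟩ v) i             ∎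
      where
      Y : _
      Y = sandwich U W ⟨$⟩ X

  -- `C ∘L L` projects onto the image of `M`, so membership in the image gives the linear condition
  -- that `dim≤` asks for. Conversely, `C` embeds its source into the image because it equals `M`
  -- after `S`.
  isRank⇒≡rank : ∀ {ρ} (M : Mat r s) → IsRank M ρ → (D : Decomposition (mulL M)) → ρ ≡ Decomposition.rank D
  isRank⇒≡rank M dim D = ℕₚ.≤-antisym
    (dim≤ dim ↔-refl (idL -L C ∘L L)
      (λ v (x , Mx≋v) i → x≈y⇒x-y≈0 (begin
        v i                              ≈⟨ Mx≋v i ⟨
        (M · x) i                        ≈⟨ CR≗f x i ⟨
        (C ⟨$⟩ R ⟨$⟩ x) i                ≈⟨ resp C (LC≗id _) i ⟨
        (C ⟨$⟩ L ⟨$⟩ C ⟨$⟩ R ⟨$⟩ x) i    ≈⟨ resp (C ∘L L) (CR≗f x) i ⟩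
        (C ⟨$⟩ L ⟨$⟩ M · x) i            ≈⟨ resp (C ∘L L) Mx≋v i ⟩
        (C ⟨$⟩ L ⟨$⟩ v) i                ∎))
      L λ v v≋CLv Lv≋0 i → trans (x-y≈0⇒x≈y _ _ (v≋CLv i)) (𝟎-hom C Lv≋0 i))
    (embedding⇒≤dim dim ↔-refl C (λ x → (S ⟨$⟩ x) , λ i → sym (C≗fS x i))
      λ x p i k → k (leftInverse⇒injective C L LC≗id p i))
    where open Decomposition D

  -- Bounds in terms of the ranks of A and B.

  module RankBounds (A : Mat r r) (B : Mat s s) {dC} (dim : IsDim (Commutant A B) dC)
                    (DA : Decomposition (mulL A)) (DB : Decomposition (mulL B)) where
    private
      module A = Decomposition DA
      module B = Decomposition DB

    lower : A.corank ℕ.* B.corank′ ℕ.≤ dC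
    lower = embedding⇒≤dim dim Finₚ.*↔× (sandwich A.U B.W)
      (λ X → intertwines⇒commutant A B _ (sandwich-intertwines A B 0# A.U B.W
        (λ x i → trans (A.fU≗0 x i) (sym (zeroˡ _))) (λ x i → trans (B.Wf≗0 x i) (sym (zeroˡ _))) X))
      λ X p x k → k (sandwich-injective A.U A.T A.TU≗id B.W B.V B.WV≗id X p x)

    -- L_A X C_B determines XB = AX; if these vanish, X is a map coker B → ker A, given by T_A X V_B.
    upper : dC ℕ.≤ A.rank ℕ.* B.rank ℕ.+ A.corank ℕ.* B.corank′
    upper = dim≤ dim (↔-trans Finₚ.+↔⊎ (Finₚ.*↔× ⊎-↔ Finₚ.*↔×)) (commutator A B) (commutant⇒ker A B)
      (pair (sandwich A.L B.C) (sandwich A.T B.V)) λ X AX≋XB p →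
      let AX≗XB = ker⇒intertwines A B X AX≋XB
          LXC≗0 : A.L ∘L apply X ∘L B.C ≗ 0L
          LXC≗0 v i = trans (sym (apply-sandwich A.L B.C X v i)) (𝟎-hom (at v) (p ∘ inj₁) i)
          TXV≗0 : A.T ∘L apply X ∘L B.V ≗ 0L
          TXV≗0 v i = trans (sym (apply-sandwich A.T B.V X v i)) (𝟎-hom (at v) (p ∘ inj₂) i)
          -- `B.C` is B after `B.S`; moving X past B shows that the values lie in the image of
          -- `A.C`.
          XC≗CRXS : apply X ∘L B.C ≗ A.C ∘L A.R ∘L apply X ∘L B.S
          XC≗CRXS v i = begin
            (apply X ⟨$⟩ B.C ⟨$⟩ v) i                ≈⟨ resp (apply X) (B.C≗fS v) i ⟩
            (apply X ⟨$⟩ mulL B ⟨$⟩ B.S ⟨$⟩ v) i     ≈⟨ AX≗XB _ i ⟨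
            (mulL A ⟨$⟩ apply X ⟨$⟩ B.S ⟨$⟩ v) i     ≈⟨ A.CR≗f _ i ⟨
            (A.C ⟨$⟩ A.R ⟨$⟩ apply X ⟨$⟩ B.S ⟨$⟩ v) i ∎
          -- `A.C ∘L A.L` fixes the image of `A.C`, so `LXC≗0` suffices.
          XC≗0 : apply X ∘L B.C ≗ 0L
          XC≗0 v i = begin
            (apply X ⟨$⟩ B.C ⟨$⟩ v) i ≈⟨ XC≗CRXS v i ⟩
            (A.C ⟨$⟩ A.R ⟨$⟩ apply X ⟨$⟩ B.S ⟨$⟩ v) i ≈⟨ resp A.C (A.LC≗id _) i ⟨
            (A.C ⟨$⟩ A.L ⟨$⟩ A.C ⟨$⟩ A.R ⟨$⟩ apply X ⟨$⟩ B.S ⟨$⟩ v) i ≈⟨ resp (A.C ∘L A.L) (XC≗CRXS v) i ⟨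
            (A.C ⟨$⟩ A.L ⟨$⟩ apply X ⟨$⟩ B.C ⟨$⟩ v) i ≈⟨ 𝟎-hom A.C (LXC≗0 v) i ⟩
            0# ∎
          XB≗0 : apply X ∘L mulL B ≗ 0L
          XB≗0 v i = trans (sym (resp (apply X) (B.CR≗f v) i)) (XC≗0 _ i)
          -- Now AX = XB = 0, so X takes values in the kernel of A, where `A.T` is injective.
          XV≗0 : apply X ∘L B.V ≗ 0L
          XV≗0 v i = trans (sym (A.ker⇒UT (λ i → trans (AX≗XB _ i) (XB≗0 _ i)) i)) (𝟎-hom A.U (TXV≗0 v) i)
      in apply≗0⇒≋𝟎 X λ v i → begin
        (apply X ⟨$⟩ v) i ≈⟨ resp (apply X) (B.CL+VW≗id v) i ⟨
        (apply X ⟨$⟩ (B.C ⟨$⟩ B.L ⟨$⟩ v) ⊕ (B.V ⟨$⟩ B.W ⟨$⟩ v)) i ≈⟨ ⊕-hom (apply X) _ _ i ⟩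
        (apply X ⟨$⟩ B.C ⟨$⟩ B.L ⟨$⟩ v) i + (apply X ⟨$⟩ B.V ⟨$⟩ B.W ⟨$⟩ v) i ≈⟨ +-cong (XC≗0 _ i) (XV≗0 _ i) ⟩
        0# + 0# ≈⟨ +-identityʳ 0# ⟩
        0# ∎

  -- Generalized eigenvectors

  iterL : ℕ → I ⊸ I → I ⊸ I
  iterL n D = record { _⟨$⟩_ = iter n (D ⟨$⟩_) ; resp = iter-resp n ; ⊕-hom = iter-⊕ n ; ⊙-hom = iter-⊙ n }
    where
    iter-resp : ∀ n {x y} → x ≋ y → iter n (D ⟨$⟩_) x ≋ iter n (D ⟨$⟩_) y
    iter-resp zero    p = p
    iter-resp (suc n) p = resp D (iter-resp n p)
    iter-⊕ : ∀ n x y → iter n (D ⟨$⟩_) (x ⊕ y) ≋ iter n (D ⟨$⟩_) x ⊕ iter n (D ⟨$⟩_) y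
    iter-⊕ zero    x y i = refl
    iter-⊕ (suc n) x y i = trans (resp D (iter-⊕ n x y) i) (⊕-hom D _ _ i)
    iter-⊙ : ∀ n b x → iter n (D ⟨$⟩_) (b ⊙ x) ≋ b ⊙ iter n (D ⟨$⟩_) x
    iter-⊙ zero    b x i = refl
    iter-⊙ (suc n) b x i = trans (resp D (iter-⊙ n b x) i) (⊙-hom D _ _ i)

  iter-suc : ∀ {x} {X : Set x} n (f : X → X) x → iter n f (f x) ≡ f (iter n f x)
  iter-suc zero    f x = ≡.refl
  iter-suc (suc n) f x = ≡.cong f (iter-suc n f x)

  iter-+ : ∀ {x} {X : Set x} m n (f : X → X) x → iter (m ℕ.+ n) f x ≡ iter m f (iter n f x)
  iter-+ zero    n f x = ≡.refl
  iter-+ (suc m) n f x = ≡.cong f (iter-+ m n f x)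

  ≡⇒≋ : {x y : I → Carrier} → x ≡ y → x ≋ y
  ≡⇒≋ ≡.refl i = refl

  shiftL : I ⊸ I → Carrier → I ⊸ I
  shiftL T α = T -L scaleL α

  -- For `T` equal to `mulL M` this unfolds to `GenEigenspace M α`, so the two are used
  -- interchangeably.
  GenEigen : I ⊸ I → Carrier → (I → Carrier) → Set ℓ
  GenEigen T α v = ∃ λ n → (iterL n (shiftL T α) ⟨$⟩ v) ≋ 𝟎

  module _ (T : I ⊸ I) where

    genEigen-resp : ∀ {α β v} → α ≈ β → GenEigen T α v → GenEigen T β v
    genEigen-resp {α} {β} α≈β (n , p) = n , λ i → trans (step n _ i) (p i)
      where
      step : ∀ n v → (iterL n (shiftL T β) ⟨$⟩ v) ≋ (iterL n (shiftL T α) ⟨$⟩ v)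
      step zero    v i = refl
      step (suc n) v i = trans (resp (shiftL T β) (step n v) i) (-‿cong₂ refl (*-congʳ (sym α≈β)))

    genEigen-⊕ : ∀ {α v w} → GenEigen T α v → GenEigen T α w → GenEigen T α (v ⊕ w)
    genEigen-⊕ {α} {v} {w} (m , p) (n , q) = m ℕ.+ n , λ i → begin
      (iterL (m ℕ.+ n) D ⟨$⟩ v ⊕ w) i ≈⟨ ⊕-hom (iterL (m ℕ.+ n) D) v w i ⟩
      (iterL (m ℕ.+ n) D ⟨$⟩ v) i + (iterL (m ℕ.+ n) D ⟨$⟩ w) i
        ≈⟨ +-cong (≡⇒≋ (≡.trans (≡.cong (λ k → iter k (D ⟨$⟩_) v) (ℕₚ.+-comm m n)) (iter-+ n m (D ⟨$⟩_) v)) i)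
                  (≡⇒≋ (iter-+ m n (D ⟨$⟩_) w) i) ⟩
      (iterL n D ⟨$⟩ iterL m D ⟨$⟩ v) i + (iterL m D ⟨$⟩ iterL n D ⟨$⟩ w) i
        ≈⟨ +-cong (𝟎-hom (iterL n D) p i) (𝟎-hom (iterL m D) q i) ⟩
      0# + 0# ≈⟨ +-identityʳ 0# ⟩
      0# ∎
      where
      D : I ⊸ I
      D = shiftL T α

    -- T − α is invertible on the generalized β-eigenspace, by u = (w − u′)/(β − α) where (T − α) u′ = (T − β) w.
    genEigen-solve : ∀ {α β} → ¬ β - α ≈ 0# → ∀ n w → (iterL n (shiftL T β) ⟨$⟩ w) ≋ 𝟎 →
                     ∃ λ u → (shiftL T α ⟨$⟩ u) ≋ w × (iterL n (shiftL T β) ⟨$⟩ u) ≋ 𝟎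
    genEigen-solve {α} {β} β≉α zero w w≋0 =
      𝟎 , (λ i → trans (𝟎-hom (shiftL T α) (λ _ → refl) i) (sym (w≋0 i))) , λ _ → refl
    genEigen-solve {α} {β} β≉α (suc n) w p
      with inverse _ β≉α
         | genEigen-solve β≉α n (shiftL T β ⟨$⟩ w) (λ i → trans (≡⇒≋ (iter-suc n (shiftL T β ⟨$⟩_) w) i) (p i))
    ... | t , [β-α]t≈1 | u′ , q , q′ = t ⊙ (w ⊖ u′) , solves , killed
      where
      Dα Dβ : I ⊸ I
      Dα = shiftL T α
      Dβ = shiftL T β
      difference : ∀ x y → (x - α * y) - (x - β * y) ≈ (β - α) * y
      difference x y = begin
        (x - α * y) - (x - β * y)         ≈⟨ +-congˡ (-x-y≈-[x+y] x (- (β * y))) ⟨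
        (x - α * y) + (- x - - (β * y))   ≈⟨ +-interchange _ _ _ _ ⟩
        (x - x) + (- (α * y) - - (β * y)) ≈⟨ +-cong (-‿inverseʳ x) (+-congˡ (-‿involutive _)) ⟩
        0# + (- (α * y) + β * y)          ≈⟨ +-identityˡ _ ⟩
        - (α * y) + β * y                 ≈⟨ +-comm _ _ ⟩
        β * y - α * y                     ≈⟨ [y-z]x≈yx-zx y β α ⟨
        (β - α) * y                       ∎
      solves : (Dα ⟨$⟩ t ⊙ (w ⊖ u′)) ≋ w
      solves i = begin
        (Dα ⟨$⟩ t ⊙ (w ⊖ u′)) i               ≈⟨ ⊙-hom Dα t _ i ⟩
        t * (Dα ⟨$⟩ w ⊖ u′) i                 ≈⟨ *-congˡ (⊖-hom Dα w u′ i) ⟩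
        t * ((Dα ⟨$⟩ w) i - (Dα ⟨$⟩ u′) i)    ≈⟨ *-congˡ (-‿cong₂ refl (q i)) ⟩
        t * ((Dα ⟨$⟩ w) i - (Dβ ⟨$⟩ w) i)     ≈⟨ *-congˡ (difference _ _) ⟩
        t * ((β - α) * w i)                   ≈⟨ *-assoc _ _ _ ⟨
        t * (β - α) * w i                     ≈⟨ *-congʳ (trans (*-comm _ _) [β-α]t≈1) ⟩
        1# * w i                              ≈⟨ *-identityˡ _ ⟩
        w i                                   ∎
      killed : (iterL (suc n) Dβ ⟨$⟩ t ⊙ (w ⊖ u′)) ≋ 𝟎
      killed i = begin
        (iterL (suc n) Dβ ⟨$⟩ t ⊙ (w ⊖ u′)) i  ≈⟨ ⊙-hom (iterL (suc n) Dβ) t _ i ⟩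
        t * (iterL (suc n) Dβ ⟨$⟩ w ⊖ u′) i    ≈⟨ *-congˡ (⊖-hom (iterL (suc n) Dβ) w u′ i) ⟩
        t * ((iterL (suc n) Dβ ⟨$⟩ w) i - (iterL (suc n) Dβ ⟨$⟩ u′) i)
          ≈⟨ *-congˡ (-‿cong₂ (p i) (𝟎-hom Dβ q′ i)) ⟩
        t * (0# - 0#)                          ≈⟨ *-congˡ (-‿inverseʳ 0#) ⟩
        t * 0#                                 ≈⟨ zeroʳ t ⟩
        0#                                     ∎

    -- An inductive predicate rather than a sum over a list of distinct eigenvalues, since equality
    -- of eigenvalues need not be decidable; `β` may repeat.
    data SumOfGenEigen : (I → Carrier) → Set (c ⊔ ℓ) where
      none : ∀ {v} → v ≋ 𝟎 → SumOfGenEigen v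
      add  : ∀ {β u w v} → GenEigen T β u → SumOfGenEigen w → v ≋ u ⊕ w → SumOfGenEigen v

    -- Summands with β ≉ α are hit by T - α through `genEigen-solve`; those with β ≈ α are gathered
    -- into the vector `z`.
    genEigen-absorb : ∀ α {w} → SumOfGenEigen w →
      ¬ ¬ ∃ λ u → ∃ λ z → SumOfGenEigen u × GenEigen T α z × w ≋ (shiftL T α ⟨$⟩ u) ⊕ z
    genEigen-absorb α (none w≋0) k = k (𝟎 , 𝟎 , none (λ _ → refl) , (0 , λ _ → refl) , λ i →
      trans (w≋0 i) (sym (trans (+-congʳ (𝟎-hom (shiftL T α) (λ _ → refl) i)) (+-identityʳ 0#))))
    genEigen-absorb α (add {β} {g} {w′} {w} gen sw w≋g+w′) k =
      genEigen-absorb α sw λ (u , z , su , sz , w′≋) → ¬¬-excluded-middle λ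
        { (yes β-α≈0) → k (u , z ⊕ g , su , genEigen-⊕ sz (genEigen-resp (x-y≈0⇒x≈y _ _ β-α≈0) gen) , λ i → begin
            w i                                    ≈⟨ w≋g+w′ i ⟩
            g i + w′ i                             ≈⟨ +-congˡ (w′≋ i) ⟩
            g i + ((shiftL T α ⟨$⟩ u) i + z i)     ≈⟨ +-comm _ _ ⟩
            ((shiftL T α ⟨$⟩ u) i + z i) + g i     ≈⟨ +-assoc _ _ _ ⟩
            (shiftL T α ⟨$⟩ u) i + (z i + g i)     ∎)
        ; (no β-α≉0) → let u′ , q , q′ = genEigen-solve β-α≉0 (proj₁ gen) g (proj₂ gen) in
            k (u′ ⊕ u , z , add (proj₁ gen , q′) su (λ _ → refl) , sz , λ i → begin
            w i                                    ≈⟨ w≋g+w′ i ⟩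
            g i + w′ i                             ≈⟨ +-cong (sym (q i)) (w′≋ i) ⟩
            (shiftL T α ⟨$⟩ u′) i + ((shiftL T α ⟨$⟩ u) i + z i)  ≈⟨ +-assoc _ _ _ ⟨
            ((shiftL T α ⟨$⟩ u′) i + (shiftL T α ⟨$⟩ u) i) + z i  ≈⟨ +-congʳ (⊕-hom (shiftL T α) u′ u i) ⟨
            (shiftL T α ⟨$⟩ u′ ⊕ u) i + z i        ∎) }

    -- Writing (T - α) v = (T - α) u + z gives (T - α)(v - u) = z, so v - u is a generalized
    -- α-eigenvector, with exponent one higher than that of z.
    sumOfGenEigen-preimage : ∀ α v → SumOfGenEigen (shiftL T α ⟨$⟩ v) → ¬ ¬ SumOfGenEigen v
    sumOfGenEigen-preimage α v sw k = genEigen-absorb α sw λ (u , z , su , (n , p) , eq) →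
      k (add {u = v ⊖ u} (suc n , λ i → trans (sym (≡⇒≋ (iter-suc n (shiftL T α ⟨$⟩_) (v ⊖ u)) i))
          (trans (resp (iterL n (shiftL T α)) (λ j → begin
            (shiftL T α ⟨$⟩ v ⊖ u) j ≈⟨ ⊖-hom (shiftL T α) v u j ⟩
            (shiftL T α ⟨$⟩ v) j - (shiftL T α ⟨$⟩ u) j ≈⟨ -‿cong₂ (eq j) refl ⟩
            ((shiftL T α ⟨$⟩ u) j + z j) - (shiftL T α ⟨$⟩ u) j ≈⟨ x+y-x≈y _ _ ⟩
            z j ∎) i) (p i)))
        su (λ i → sym ([x-y]+y≈x _ _)))

  genEigen-map : (T : I ⊸ I) (T′ : J ⊸ J) (X : I ⊸ J) → T′ ∘L X ≗ X ∘L T →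
                 ∀ {α v} → GenEigen T α v → GenEigen T′ α (X ⟨$⟩ v)
  genEigen-map T T′ X T′X≗XT {α} (n , p) = n , λ i → trans (commutes n _ i) (𝟎-hom X p i)
    where
    commutes : ∀ n v → (iterL n (shiftL T′ α) ⟨$⟩ X ⟨$⟩ v) ≋ (X ⟨$⟩ iterL n (shiftL T α) ⟨$⟩ v)
    commutes zero    v i = refl
    commutes (suc n) v i = begin
      (shiftL T′ α ⟨$⟩ iterL n (shiftL T′ α) ⟨$⟩ X ⟨$⟩ v) i   ≈⟨ resp (shiftL T′ α) (commutes n v) i ⟩
      (T′ ⟨$⟩ X ⟨$⟩ w) i - α * (X ⟨$⟩ w) i   ≈⟨ -‿cong₂ (T′X≗XT w i) (sym (⊙-hom X α w i)) ⟩
      (X ⟨$⟩ T ⟨$⟩ w) i - (X ⟨$⟩ α ⊙ w) i    ≈⟨ ⊖-hom X _ _ i ⟨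
      (X ⟨$⟩ shiftL T α ⟨$⟩ w) i             ∎
      where
      w : _
      w = iterL n (shiftL T α) ⟨$⟩ v

  -- Monic polynomials in an operator, and division by a linear factor.

  -- The leading coefficient 1 is implicit: a lists the lower ones in ascending order.
  horner : ∀ n → (Fin n → Carrier) → I ⊸ I → I ⊸ I
  horner zero    a T = idL
  horner (suc n) a T = horner n (a ∘ suc) T ∘L T +L scaleL (a zero)

  horner-expand : ∀ n a (T : I ⊸ I) v i →
    (horner n a T ⟨$⟩ v) i ≈ iter n (T ⟨$⟩_) v i + Σ[<] n (λ k → a k * iter (toℕ k) (T ⟨$⟩_) v i)
  horner-expand zero    a T v i = sym (+-identityʳ _)
  horner-expand (suc n) a T v i = begin
    (horner n (a ∘ suc) T ⟨$⟩ T ⟨$⟩ v) i + a zero * v i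
      ≈⟨ +-congʳ (horner-expand n (a ∘ suc) T (T ⟨$⟩ v) i) ⟩
    (iter n (T ⟨$⟩_) (T ⟨$⟩ v) i + Σ[<] n (λ k → a (suc k) * iter (toℕ k) (T ⟨$⟩_) (T ⟨$⟩ v) i)) + a zero * v i
      ≈⟨ +-congʳ (+-cong (≡⇒≋ (iter-suc n (T ⟨$⟩_) v) i) (Σ-cong n (λ k → *-congˡ (≡⇒≋ (iter-suc (toℕ k) (T ⟨$⟩_) v) i)))) ⟩
    (iter (suc n) (T ⟨$⟩_) v i + Σ[<] n (λ k → a (suc k) * iter (suc (toℕ k)) (T ⟨$⟩_) v i)) + a zero * v i
      ≈⟨ +-assoc _ _ _ ⟩
    iter (suc n) (T ⟨$⟩_) v i + (Σ[<] n (λ k → a (suc k) * iter (suc (toℕ k)) (T ⟨$⟩_) v i) + a zero * v i)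
      ≈⟨ +-congˡ (+-comm _ _) ⟩
    iter (suc n) (T ⟨$⟩_) v i + Σ[<] (suc n) (λ k → a k * iter (toℕ k) (T ⟨$⟩_) v i) ∎

  -- The coefficients of p + x q for p monic of degree n + 1 and q monic of degree n. The implicit
  -- leading 1 of q accounts for the bare `x` in the base case.
  addMultiple : ∀ n → (Fin (suc n) → Carrier) → Carrier → (Fin n → Carrier) → Fin (suc n) → Carrier
  addMultiple zero    a x q zero    = a zero + x
  addMultiple (suc n) a x q zero    = a zero + x * q zero
  addMultiple (suc n) a x q (suc i) = addMultiple n (a ∘ suc) x (q ∘ suc) i

  horner-addMultiple : ∀ n a x q (T : I ⊸ I) v i →
    (horner (suc n) (addMultiple n a x q) T ⟨$⟩ v) i ≈ (horner (suc n) a T ⟨$⟩ v) i + x * (horner n q T ⟨$⟩ v) i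
  horner-addMultiple zero    a x q T v i = trans (+-congˡ (distribʳ _ _ _)) (sym (+-assoc _ _ _))
  horner-addMultiple (suc n) a x q T v i = begin
    (horner (suc n) (addMultiple n (a ∘ suc) x (q ∘ suc)) T ⟨$⟩ T ⟨$⟩ v) i + (a zero + x * q zero) * v i
      ≈⟨ +-cong (horner-addMultiple n (a ∘ suc) x (q ∘ suc) T (T ⟨$⟩ v) i)
                (trans (distribʳ _ _ _) (+-congˡ (*-assoc _ _ _))) ⟩
    ((horner (suc n) (a ∘ suc) T ⟨$⟩ T ⟨$⟩ v) i + x * (horner n (q ∘ suc) T ⟨$⟩ T ⟨$⟩ v) i) + (a zero * v i + x * (q zero * v i))
      ≈⟨ +-interchange _ _ _ _ ⟩
    (horner (suc (suc n)) a T ⟨$⟩ v) i + (x * (horner n (q ∘ suc) T ⟨$⟩ T ⟨$⟩ v) i + x * (q zero * v i))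
      ≈⟨ +-congˡ (distribˡ _ _ _) ⟨
    (horner (suc (suc n)) a T ⟨$⟩ v) i + x * (horner (suc n) q T ⟨$⟩ v) i ∎

  -- Synthetic division by t - x: if p = (t - x) q + ρ, then t p + a₀ = (t - x)(p + x q) + (x ρ +
  -- a₀).
  quotient : ∀ n → (Fin (suc n) → Carrier) → Carrier → Fin n → Carrier
  quotient (suc n) a x = addMultiple n (a ∘ suc) x (quotient n (a ∘ suc) x)

  remainder : ∀ n → (Fin (suc n) → Carrier) → Carrier → Carrier
  remainder zero    a x = x + a zero
  remainder (suc n) a x = x * remainder n (a ∘ suc) x + a zero

  horner-division : ∀ n a x (T : I ⊸ I) v i →
    (horner (suc n) a T ⟨$⟩ v) i ≈ (horner n (quotient n a x) T ⟨$⟩ shiftL T x ⟨$⟩ v) i + remainder n a x * v i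
  horner-division zero a x T v i = sym (begin
    ((T ⟨$⟩ v) i - x * v i) + (x + a zero) * v i           ≈⟨ +-congˡ (distribʳ _ _ _) ⟩
    ((T ⟨$⟩ v) i - x * v i) + (x * v i + a zero * v i)     ≈⟨ +-assoc _ _ _ ⟨
    (((T ⟨$⟩ v) i - x * v i) + x * v i) + a zero * v i     ≈⟨ +-congʳ ([x-y]+y≈x _ _) ⟩
    (T ⟨$⟩ v) i + a zero * v i                             ∎)
  horner-division (suc n) a x T v i = begin
    (P ⟨$⟩ T ⟨$⟩ v) i + a zero * v i
      ≈⟨ +-congʳ (resp P (λ j → sym ([x-y]+y≈x _ (x * v j))) i) ⟩
    (P ⟨$⟩ w ⊕ x ⊙ v) i + a zero * v i
      ≈⟨ +-congʳ (trans (⊕-hom P w (x ⊙ v) i) (+-congˡ (⊙-hom P x v i))) ⟩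
    ((P ⟨$⟩ w) i + x * (P ⟨$⟩ v) i) + a zero * v i
      ≈⟨ +-congʳ (+-congˡ (trans (*-congˡ (horner-division n (a ∘ suc) x T v i)) (trans (distribˡ _ _ _) (+-congˡ (sym (*-assoc _ _ _)))))) ⟩
    ((P ⟨$⟩ w) i + (x * (horner n q T ⟨$⟩ w) i + x * remainder n (a ∘ suc) x * v i)) + a zero * v i
      ≈⟨ trans (+-congʳ (sym (+-assoc _ _ _))) (+-assoc _ _ _) ⟩
    ((P ⟨$⟩ w) i + x * (horner n q T ⟨$⟩ w) i) + (x * remainder n (a ∘ suc) x * v i + a zero * v i)
      ≈⟨ +-cong (sym (horner-addMultiple n (a ∘ suc) x q T w i)) (sym (distribʳ _ _ _)) ⟩
    (horner (suc n) (quotient (suc n) a x) T ⟨$⟩ w) i + remainder (suc n) a x * v i ∎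
    where
    P : _
    P = horner (suc n) (a ∘ suc) T
    q : _
    q = quotient n (a ∘ suc) x
    w : _
    w = shiftL T x ⟨$⟩ v

  pow≈iter : ∀ x n → pow x n ≈ iter n (scaleL {⊤} x ⟨$⟩_) (λ _ → 1#) tt
  pow≈iter x zero    = refl
  pow≈iter x (suc n) = *-congˡ (pow≈iter x n)

  -- Division is applied with multiplication by `x` on a one-dimensional space as the operator, at
  -- the vector 1: there T - x is zero, so only the remainder is left.
  root⇒remainder≈0 : ∀ n a x → pow x (suc n) + Σ[<] (suc n) (λ i → a i * pow x (toℕ i)) ≈ 0# → remainder n a x ≈ 0#
  root⇒remainder≈0 n a x root = begin
    remainder n a x          ≈⟨ *-identityʳ _ ⟨
    remainder n a x * 1#     ≈⟨ +-identityˡ _ ⟨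
    0# + remainder n a x * 1#
      ≈⟨ +-congʳ (𝟎-hom (horner n (quotient n a x) X) (λ _ → -‿inverseʳ (x * 1#)) tt) ⟨
    (horner n (quotient n a x) X ⟨$⟩ shiftL X x ⟨$⟩ 𝟏) tt + remainder n a x * 1#
      ≈⟨ horner-division n a x X 𝟏 tt ⟨
    (horner (suc n) a X ⟨$⟩ 𝟏) tt
      ≈⟨ horner-expand (suc n) a X 𝟏 tt ⟩
    _ ≈⟨ +-cong (pow≈iter x (suc n)) (Σ-cong (suc n) (λ i → *-congˡ {a i} (pow≈iter x (toℕ i)))) ⟨
    pow x (suc n) + Σ[<] (suc n) (λ i → a i * pow x (toℕ i)) ≈⟨ root ⟩
    0# ∎
    where
    X : ⊤ ⊸ ⊤
    X = scaleL x
    𝟏 : ⊤ → Carrier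
    𝟏 _ = 1#

  -- Krylov vectors and annihilating polynomials.

  Σ-last : ∀ n (f : Fin (suc n) → Carrier) → Σ[<] (suc n) f ≈ Σ[<] n (f ∘ inject₁) + f (fromℕ n)
  Σ-last zero    f = +-comm _ _
  Σ-last (suc n) f = trans (+-congˡ (Σ-last n (f ∘ suc))) (sym (+-assoc _ _ _))

  -- A relation with nonzero leading coefficient could be divided by it to give a monic annihilator.
  -- So the leading coefficient is not nonzero, and once it vanishes the relation is shorter.
  krylov-independent : (T : I ⊸ I) (v : I → Carrier) → ¬ (∃ λ n → ∃ λ a → (horner n a T ⟨$⟩ v) ≋ 𝟎) →
    ∀ m → WeaklyInjective (span {m} (λ k → iter (toℕ k) (T ⟨$⟩_) v))
  krylov-independent T v noAnn (suc m) cs p i ¬q = leading λ l≈0 → by-position l≈0 (view i) ¬q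
    where
    K′ : ℕ → _
    K′ k = iter k (T ⟨$⟩_) v
    lower : _ → Carrier
    lower i = Σ[<] m (λ k → cs (inject₁ k) * K′ (toℕ k) i)
    split : ∀ i → lower i + cs (fromℕ m) * K′ m i ≈ 0#
    split i = begin
      lower i + cs (fromℕ m) * K′ m i
        ≈⟨ +-cong (Σ-cong m (λ k → *-congˡ (≡⇒≋ (≡.cong K′ (Finₚ.toℕ-inject₁ k)) i)))
                  (*-congˡ (≡⇒≋ (≡.cong K′ (Finₚ.toℕ-fromℕ m)) i)) ⟨
      _ ≈⟨ Σ-last m (λ k → cs k * K′ (toℕ k) i) ⟨
      Σ[<] (suc m) (λ k → cs k * K′ (toℕ k) i) ≈⟨ p i ⟩
      0# ∎
    leading : ¬ ¬ cs (fromℕ m) ≈ 0#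
    leading l≉0 = let t , lt≈1 = inverse _ l≉0 in noAnn (m , (λ k → t * cs (inject₁ k)) , λ i → begin
      _ ≈⟨ horner-expand m _ T v i ⟩
      K′ m i + Σ[<] m (λ k → t * cs (inject₁ k) * K′ (toℕ k) i)
        ≈⟨ +-cong (trans (sym (*-identityˡ _)) (trans (*-congʳ (trans (sym lt≈1) (*-comm _ _))) (*-assoc _ _ _)))
                  (trans (Σ-cong m (λ k → *-assoc _ _ _)) (Σ-* m t _)) ⟩
      t * (cs (fromℕ m) * K′ m i) + t * lower i ≈⟨ distribˡ _ _ _ ⟨
      t * (cs (fromℕ m) * K′ m i + lower i)     ≈⟨ *-congˡ (trans (+-comm _ _) (split i)) ⟩
      t * 0#                                    ≈⟨ zeroʳ t ⟩
      0#                                        ∎)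
    by-position : cs (fromℕ m) ≈ 0# → ∀ {i} → View i → ¬ ¬ cs i ≈ 0#
    by-position l≈0 ‵fromℕ       ¬q = ¬q l≈0
    by-position l≈0 (‵inject₁ i) ¬q = krylov-independent T v noAnn m (cs ∘ inject₁)
      (λ j → x+y≈0∧y≈0⇒x≈0 (split j) (trans (*-congʳ l≈0) (zeroˡ _))) i ¬q

  -- The n + 1 vectors v, T v, ..., Tⁿ v in dimension n cannot be independent; this takes the place
  -- of the Cayley-Hamilton theorem.
  annihilator : (T : Fin n ⊸ Fin n) (v : Fin n → Carrier) → ¬ ¬ (∃ λ m → ∃ λ a → (horner m a T ⟨$⟩ v) ≋ 𝟎)
  annihilator {n} T v noAnn = ℕₚ.<-irrefl ≡.refl (injective⇒≤ (span (λ k → iter (toℕ k) (T ⟨$⟩_) v)) (krylov-independent T v noAnn (suc n)))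

  -- Decomposition into generalized eigenvectors over an algebraically closed field.

  module AlgebraicallyClosed
    (algClosed : ∀ n (a : Fin (suc n) → Carrier) →
                 ∃ λ x → pow x (suc n) + Σ[<] (suc n) (λ i → a i * pow x (toℕ i)) ≈ 0#) where

    -- A root x splits off the factor T - x, leaving a quotient of lower degree that annihilates (T
    -- - x) v; the decomposition of that vector is pulled back by `sumOfGenEigen-preimage`.
    annihilated⇒sumOfGenEigen : ∀ n a (T : I ⊸ I) v → (horner n a T ⟨$⟩ v) ≋ 𝟎 → ¬ ¬ SumOfGenEigen T v
    annihilated⇒sumOfGenEigen zero    a T v v≋0 k = k (none v≋0)
    annihilated⇒sumOfGenEigen (suc n) a T v p k = let x , root = algClosed n a in
      annihilated⇒sumOfGenEigen n (quotient n a x) T (shiftL T x ⟨$⟩ v)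
        (λ i → x+y≈0∧y≈0⇒x≈0 (trans (sym (horner-division n a x T v i)) (p i))
                 (trans (*-congʳ (root⇒remainder≈0 n a x root)) (zeroˡ _)))
        λ s → sumOfGenEigen-preimage T x v s k

    sumOfGenEigen : (T : Fin n ⊸ Fin n) (v : Fin n → Carrier) → ¬ ¬ SumOfGenEigen T v
    sumOfGenEigen T v k = annihilator T v λ (m , a , p) → annihilated⇒sumOfGenEigen m a T v p k

  -- Independent elements of the commutant built from eigenspaces.

  isDim-eigenspace⇒≤corank : ∀ {k α} (M : Mat r r) → IsDim (Eigenspace M α) k →
    (D : Decomposition (shiftL (mulL M) α)) → k ℕ.≤ Decomposition.corank D
  isDim-eigenspace⇒≤corank {α = α} M dim D = dim≤ dim ↔-refl (shiftL (mulL M) α) (λ v p i → x≈y⇒x-y≈0 (p i))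
    T λ v Dv≋0 Tv≋0 i → trans (sym (ker⇒UT Dv≋0 i)) (𝟎-hom U Tv≋0 i)
    where open Decomposition D

  leftMul : Mat r r → (Fin r × Fin s) ⊸ (Fin r × Fin s)
  leftMul A = tuple (λ j → mulL A ∘L at (e j))

  -- The weights are eigenvalues of X ↦ AX; they make summands for distinct α independent.
  record EigenEmbedding (A : Mat r r) (B : Mat s s) (l : List Carrier) : Set (Level.suc Level.zero ⊔ c ⊔ ℓ) where
    field
      {Index}     : Set
      size        : ℕ
      index       : Fin size ↔ Index
      embed       : Index ⊸ (Fin r × Fin s)
      injective   : ∀ x → (embed ⟨$⟩ x) ≋ 𝟎 → x ≋ 𝟎
      commutes    : ∀ x → (commutator A B ⟨$⟩ embed ⟨$⟩ x) ≋ 𝟎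
      weight      : Index → Carrier
      weight∈l    : ∀ i → weight i ∈ l
      diagonal    : ∀ x → (leftMul A ⟨$⟩ embed ⟨$⟩ x) ≋ (embed ⟨$⟩ (λ i → weight i * x i))

  empty : (A : Mat r r) (B : Mat s s) → EigenEmbedding A B []
  empty A B = record
    { size = 0 ; index = Finₚ.0↔⊥ ; embed = 0L ; injective = λ _ _ () ; commutes = λ x → 𝟎-hom (commutator A B) (λ _ → refl)
    ; weight = λ () ; weight∈l = λ () ; diagonal = λ x → 𝟎-hom (leftMul A) (λ _ → refl) }

  -- If `f` x₁ + `embed` x₂ = 0, then applying Y ↦ AY - αY kills the first summand and multiplies
  -- the coordinates of x₂ by the nonzero values `weight i - α`. Injectivity of `embed` gives x₂ =
  -- 0, and that of `f` then gives x₁ = 0.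
  extend : (A : Mat r r) (B : Mat s s) {α : Carrier} {l : List Carrier} → All (λ β → ¬ α ≈ β) l →
           (DA : Decomposition (shiftL (mulL A) α)) (DB : Decomposition (shiftL (mulL B) α)) →
           EigenEmbedding A B l → EigenEmbedding A B (α ∷ l)
  extend A B {α} {l} α∉l DA DB E = record
    { size      = A.corank ℕ.* B.corank′ ℕ.+ size
    ; index     = ↔-trans Finₚ.+↔⊎ (Finₚ.*↔× ⊎-↔ index)
    ; embed     = copair f embed
    ; injective = λ x p →
        let g≋0 : (embed ⟨$⟩ (λ i → (weight i - α) * x (inj₂ i))) ≋ 𝟎
            g≋0 ij = begin
              (embed ⟨$⟩ (λ i → (weight i - α) * y x i)) ij
                ≈⟨ resp embed (λ i → [y-z]x≈yx-zx (y x i) (weight i) α) ij ⟩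
              (embed ⟨$⟩ ((λ i → weight i * y x i) ⊖ α ⊙ y x)) ij
                ≈⟨ ⊖-hom embed (λ i → weight i * y x i) (α ⊙ y x) ij ⟩
              (embed ⟨$⟩ (λ i → weight i * y x i)) ij - (embed ⟨$⟩ α ⊙ y x) ij
                ≈⟨ -‿cong₂ (sym (diagonal (y x) ij)) (⊙-hom embed α (y x) ij) ⟩
              (leftMul A ⟨$⟩ embed ⟨$⟩ y x) ij - α * (embed ⟨$⟩ y x) ij
                ≈⟨ +-identityˡ _ ⟨
              0# + ((leftMul A ⟨$⟩ embed ⟨$⟩ y x) ij - α * (embed ⟨$⟩ y x) ij)
                ≈⟨ +-congʳ (x≈y⇒x-y≈0 (Af≗αf (x ∘ inj₁) ij)) ⟨
              ((leftMul A ⟨$⟩ f ⟨$⟩ x ∘ inj₁) ij - α * (f ⟨$⟩ x ∘ inj₁) ij) + ((leftMul A ⟨$⟩ embed ⟨$⟩ y x) ij - α * (embed ⟨$⟩ y x) ij)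
                ≈⟨ ⊕-hom (shiftL (leftMul A) α) (f ⟨$⟩ x ∘ inj₁) (embed ⟨$⟩ y x) ij ⟨
              (shiftL (leftMul A) α ⟨$⟩ copair f embed ⟨$⟩ x) ij
                ≈⟨ 𝟎-hom (shiftL (leftMul A) α) p ij ⟩
              0# ∎
            y≋0 : y x ≋ 𝟎
            y≋0 i = *-cancelˡ-0 (λ q → All.lookup α∉l (weight∈l i) (sym (x-y≈0⇒x≈y _ _ q))) (injective _ g≋0 i)
        in λ { (inj₁ ab) → f-injective (x ∘ inj₁) (λ ij → x+y≈0∧y≈0⇒x≈0 (p ij) (𝟎-hom embed y≋0 ij)) ab
             ; (inj₂ i)  → y≋0 i }
    ; commutes  = λ x ij → begin
        (commutator A B ⟨$⟩ copair f embed ⟨$⟩ x) ij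
          ≈⟨ ⊕-hom (commutator A B) (f ⟨$⟩ x ∘ inj₁) (embed ⟨$⟩ y x) ij ⟩
        (commutator A B ⟨$⟩ f ⟨$⟩ x ∘ inj₁) ij + (commutator A B ⟨$⟩ embed ⟨$⟩ y x) ij
          ≈⟨ +-cong (commutant⇒ker A B _ (intertwines⇒commutant A B _ (sandwich-intertwines A B α A.U B.W AU≗αU WB≗αW (x ∘ inj₁))) ij)
                    (commutes (y x) ij) ⟩
        0# + 0# ≈⟨ +-identityʳ 0# ⟩
        0# ∎
    ; weight    = Sum.[ (λ _ → α) , weight ]
    ; weight∈l  = λ { (inj₁ _) → here ≡.refl ; (inj₂ i) → there (weight∈l i) }
    ; diagonal  = λ x ij → begin
        (leftMul A ⟨$⟩ copair f embed ⟨$⟩ x) ij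
          ≈⟨ ⊕-hom (leftMul A) (f ⟨$⟩ x ∘ inj₁) (embed ⟨$⟩ y x) ij ⟩
        (leftMul A ⟨$⟩ f ⟨$⟩ x ∘ inj₁) ij + (leftMul A ⟨$⟩ embed ⟨$⟩ y x) ij
          ≈⟨ +-cong (trans (Af≗αf (x ∘ inj₁) ij) (sym (⊙-hom f α (x ∘ inj₁) ij))) (diagonal (y x) ij) ⟩
        (f ⟨$⟩ α ⊙ (x ∘ inj₁)) ij + (embed ⟨$⟩ (λ i → weight i * y x i)) ij ∎
    }
    where
    open EigenEmbedding E
    module A = Decomposition DA
    module B = Decomposition DB
    y : (_ ⊎ Index → Carrier) → Index → Carrier
    y x = x ∘ inj₂
    f : (Fin A.corank × Fin B.corank′) ⊸ _
    f = sandwich A.U B.W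
    f-injective : ∀ x → (f ⟨$⟩ x) ≋ 𝟎 → x ≋ 𝟎
    f-injective = sandwich-injective A.U A.T A.TU≗id B.W B.V B.WV≗id
    AU≗αU : mulL A ∘L A.U ≗ scaleL α ∘L A.U
    AU≗αU x i = x-y≈0⇒x≈y _ _ (A.fU≗0 x i)
    WB≗αW : B.W ∘L mulL B ≗ scaleL α ∘L B.W
    WB≗αW x i = x-y≈0⇒x≈y _ _ (begin
      (B.W ⟨$⟩ mulL B ⟨$⟩ x) i - α * (B.W ⟨$⟩ x) i        ≈⟨ -‿cong₂ refl (⊙-hom B.W α x i) ⟨
      (B.W ⟨$⟩ mulL B ⟨$⟩ x) i - (B.W ⟨$⟩ α ⊙ x) i        ≈⟨ ⊖-hom B.W _ _ i ⟨
      (B.W ⟨$⟩ shiftL (mulL B) α ⟨$⟩ x) i                 ≈⟨ B.Wf≗0 x i ⟩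
      0#                                                  ∎)
    Af≗αf : ∀ x → (leftMul A ⟨$⟩ f ⟨$⟩ x) ≋ α ⊙ (f ⟨$⟩ x)
    Af≗αf x (i , j) = trans (resp (mulL A) (apply-e (f ⟨$⟩ x) j) i) (AU≗αU _ i)

  eigenEmbedding : (A : Mat r r) (B : Mat s s) (kA kB : Carrier → ℕ) →
    (∀ α → IsDim (Eigenspace A α) (kA α)) → (∀ α → IsDim (Eigenspace B α) (kB α)) →
    ∀ l → AllPairs (λ x y → ¬ x ≈ y) l →
    ¬ ¬ Σ (EigenEmbedding A B l) λ E → sum (map (λ α → kA α ℕ.* kB α) l) ℕ.≤ EigenEmbedding.size E
  eigenEmbedding A B kA kB dimA dimB [] [] k = k (empty A B , z≤n)
  eigenEmbedding A B kA kB dimA dimB (α ∷ l) (α∉l ∷ distinct) k =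
    eigenEmbedding A B kA kB dimA dimB l distinct λ (E , le) →
    decomposition (shiftL (mulL A) α) λ DA → decomposition (shiftL (mulL B) α) λ DB →
    k (extend A B α∉l DA DB E , ℕₚ.+-mono-≤
      (ℕₚ.*-mono-≤ (isDim-eigenspace⇒≤corank A (dimA α) DA)
        -- The factor for B counts the left kernel of B - α, which has the same dimension as the
        -- kernel because B is square.
        (ℕₚ.≤-trans (isDim-eigenspace⇒≤corank B (dimB α) DB) (ℕₚ.≤-reflexive (corank≡corank′ DB)))) le)

  -- Coordinates of commutant elements on generalized eigenspaces.

  module GenEigenCoordinates (A : Mat r r) (B : Mat s s) (mA mB : Carrier → ℕ)
    (dimA : ∀ α → IsDim (GenEigenspace A α) (mA α)) (dimB : ∀ α → IsDim (GenEigenspace B α) (mB α))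
    (b : Fin d → Fin r × Fin s → Carrier) (b-commutes : ∀ k → Commutant A B (b k)) where

    X : (Fin d → Carrier) → Fin s ⊸ Fin r
    X cs = apply (span b ⟨$⟩ cs)

    genEigen-X : ∀ cs {α v} → GenEigenspace B α v → GenEigenspace A α (X cs ⟨$⟩ v)
    genEigen-X cs = genEigen-map (mulL B) (mulL A) (X cs)
      (ker⇒intertwines A B _ (ker-lincomb (commutator A B) (λ k → commutant⇒ker A B _ (b-commutes k)) cs))

    Kills : (Fin d → Carrier) → Carrier → Set (c ⊔ ℓ)
    Kills cs α = ∀ v → GenEigenspace B α v → (X cs ⟨$⟩ v) ≋ 𝟎

    -- X maps the generalized α-eigenspace of B into that of A. In the given bases this restriction
    -- is a block with `mA α` rows and `mB α` columns, whose entries depend linearly on `cs`.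
    local : ∀ α → Σ (Fin d ⊸ (Fin (mA α) × Fin (mB α))) λ h → ∀ cs → (h ⟨$⟩ cs) ≋ 𝟎 → Kills cs α
    local α = tuple (λ j → proj₁ (coords j)) , λ cs p v v∈gen i →
      let ds , v≋ = spanB v v∈gen in begin
        (X cs ⟨$⟩ v) i                          ≈⟨ resp (X cs) v≋ i ⟩
        (X cs ⟨$⟩ lincomb _ ds bB) i            ≈⟨ ker-lincomb (X cs) (λ j i →
            trans (proj₂ (coords j) cs i) (𝟎-hom (span bA) (λ a → p (a , j)) i)) ds i ⟩
        0#                                      ∎
      where
      bA : _
      bA = proj₁ (dimA α)
      spanA : _
      spanA = proj₂ (proj₂ (proj₂ (dimA α)))
      bB : _
      bB = proj₁ (dimB α)
      spanB : _
      spanB = proj₂ (proj₂ (proj₂ (dimB α)))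
      coords : ∀ j → Σ (Fin d ⊸ Fin (mA α)) λ Z → at (bB j) ∘L span b ≗ span bA ∘L Z
      coords j = factor (at (bB j) ∘L span b) bA λ k → spanA _ (genEigen-X (e k) (proj₁ (proj₂ (dimB α)) j))

    record Coordinates (l : List Carrier) : Set (Level.suc Level.zero ⊔ c ⊔ ℓ) where
      field
        {Index} : Set
        index   : Fin (sum (map (λ α → mA α ℕ.* mB α) l)) ↔ Index
        coords  : Fin d ⊸ Index
        kills   : ∀ cs → (coords ⟨$⟩ cs) ≋ 𝟎 → All (Kills cs) l

    coordinates : ∀ l → Coordinates l
    coordinates []      = record { index = Finₚ.0↔⊥ ; coords = 0L ; kills = λ _ _ → [] }
    coordinates (α ∷ l) = record
      { index  = ↔-trans Finₚ.+↔⊎ (Finₚ.*↔× ⊎-↔ index)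
      ; coords = pair (proj₁ (local α)) coords
      ; kills  = λ cs p → proj₂ (local α) cs (p ∘ inj₁) ∷ kills cs (p ∘ inj₂) }
      where open Coordinates (coordinates l)

    dim≡0⇒≋𝟎 : ∀ {n v} {p} {P : (Fin n → Carrier) → Set p} {k} → IsDim P k → k ≡ 0 → P v → v ≋ 𝟎
    dim≡0⇒≋𝟎 (_ , _ , _ , spans) ≡.refl v∈P i = proj₂ (spans _ v∈P) i

    -- The list is only known to contain the α with `mA α * mB α` nonzero. For any other α one of
    -- the two generalized eigenspaces is zero, so the restriction of X has zero source or zero
    -- target.
    kills-all : ∀ {l} → (∀ α → ¬ mA α ℕ.* mB α ≡ 0 → Any (α ≈_) l) →
                ∀ cs → All (Kills cs) l → ∀ α → Kills cs α
    kills-all support cs killed α v v∈gen with mA α ℕ.* mB α ℕ.≟ 0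
    ... | yes mm≡0 with ℕₚ.m*n≡0⇒m≡0∨n≡0 (mA α) mm≡0
    ...   | inj₁ mA≡0 = dim≡0⇒≋𝟎 (dimA α) mA≡0 (genEigen-X cs v∈gen)
    ...   | inj₂ mB≡0 = 𝟎-hom (X cs) (dim≡0⇒≋𝟎 (dimB α) mB≡0 v∈gen)
    kills-all support cs killed α v v∈gen | no mm≢0 =
      let kills-β , α≈β = All.lookupAny killed (support α mm≢0)
      in kills-β v (genEigen-resp (mulL B) α≈β v∈gen)

    kills-sum : ∀ cs → (∀ α → Kills cs α) → ∀ {v} → SumOfGenEigen (mulL B) v → (X cs ⟨$⟩ v) ≋ 𝟎
    kills-sum cs kills (none v≋0) = 𝟎-hom (X cs) v≋0
    kills-sum cs kills (add {u = u} {w} {v} gen sw v≋u+w) i = begin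
      (X cs ⟨$⟩ v) i                       ≈⟨ resp (X cs) v≋u+w i ⟩
      (X cs ⟨$⟩ u ⊕ w) i                   ≈⟨ ⊕-hom (X cs) u w i ⟩
      (X cs ⟨$⟩ u) i + (X cs ⟨$⟩ w) i      ≈⟨ +-cong (kills _ u gen i) (kills-sum cs kills sw i) ⟩
      0# + 0#                              ≈⟨ +-identityʳ 0# ⟩
      0#                                   ∎

open import Data.Nat using (_+_; _*_; _∸_; _≤_)

-- Passage from F to its algebraic closure.

module BaseChange {c ℓ c′ ℓ′} (F : Field c ℓ) (Fb : AlgebraicClosure F c′ ℓ′) where
  open AlgebraicClosure Fb
  private
    module F = Field F
    module K = Field K
    module LF where
      open LinAlg F public
      open Linear F public
    module LK where
      open LinAlg K public
      open Linear K public
  open LF using () renaming (_⊸_ to _⊸F_; _⟨$⟩_ to _⟨$⟩F_)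
  open LK using (_⊸_; _⟨$⟩_; _≋_; 𝟎; _∘L_; _≗_)
  open Inverse using (to; from; strictlyInverseˡ; strictlyInverseʳ)
  open Relation.Binary.Reasoning.Setoid K.setoid

  private variable
    I J : Set
    m n d : ℕ

  ι-0 : ι F.0# K.≈ K.0#
  ι-0 = x+x≈x⇒x≈0 _ (K.trans (K.sym (ι-+ F.0# F.0#)) (ι-cong (F.+-identityʳ F.0#)))
    where open Algebra.Properties.Ring K.ring using (x+x≈x⇒x≈0)

  ι-neg : ∀ x → ι (F.- x) K.≈ K.- ι x
  ι-neg x = inverseˡ-unique _ _ (K.trans (K.sym (ι-+ (F.- x) x)) (K.trans (ι-cong (F.-‿inverseˡ x)) ι-0))
    where open Algebra.Properties.AbelianGroup K.+-abelianGroup using (inverseˡ-unique)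

  ι-Σ : ∀ n f → ι (LF.Σ[<] n f) K.≈ LK.Σ[<] n (ι ∘ f)
  ι-Σ zero    f = ι-0
  ι-Σ (suc n) f = K.trans (ι-+ _ _) (K.+-congˡ (ι-Σ n (f ∘ suc)))

  ι-e : ∀ (i j : Fin n) → ι (LF.e i j) K.≈ LK.e i j
  ι-e zero    zero    = ι-1
  ι-e zero    (suc j) = ι-0
  ι-e (suc i) zero    = ι-0
  ι-e (suc i) (suc j) = ι-e i j

  ι-lincomb : ∀ d cs (b : Fin d → I → F.Carrier) i →
              ι (LF.lincomb d cs b i) K.≈ LK.lincomb d (ι ∘ cs) (λ k → ι ∘ b k) i
  ι-lincomb d cs b i = K.trans (ι-Σ d _) (LK.Σ-cong d (λ k → ι-* _ _))

  ι-· : ∀ {r s} (M : LF.Mat r s) v i → ι ((M LF.· v) i) K.≈ (liftMat Fb M LK.· (ι ∘ v)) i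
  ι-· {s = s} M v i = K.trans (ι-Σ s _) (LK.Σ-cong s (λ k → ι-* _ _))

  -- The matrix of `f` with `ι` applied to its entries, read off from the values at the vectors
  -- `LF.e k`.
  lift : Fin n ⊸F J → Fin n ⊸ J
  lift f = LK.span (λ k → ι ∘ (f ⟨$⟩F LF.e k))

  lift-ι : ∀ (f : Fin n ⊸F J) x → (lift f ⟨$⟩ (ι ∘ x)) ≋ (ι ∘ (f ⟨$⟩F x))
  lift-ι {n} f x j = K.trans (K.sym (ι-lincomb n x (λ k → f ⟨$⟩F LF.e k) j)) (ι-cong (F.sym (LF.as-lincomb f x j)))

  lift-e : ∀ (f : Fin n ⊸F J) k → (lift f ⟨$⟩ LK.e k) ≋ (ι ∘ (f ⟨$⟩F LF.e k))
  lift-e f = LK.lincomb-e (λ k → ι ∘ (f ⟨$⟩F LF.e k))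

  -- An injective matrix over F has a left inverse over F, and the equation saying so is preserved
  -- by `ι`.
  independent-lift : Fin n ↔ I → (b : Fin d → I → F.Carrier) →
    (∀ cs → (∀ i → LF.lincomb d cs b i F.≈ F.0#) → ∀ k → cs k F.≈ F.0#) →
    ¬ ¬ (∀ cs → (LK.span (λ k → ι ∘ b k) ⟨$⟩ cs) ≋ 𝟎 → cs ≋ 𝟎)
  independent-lift {n} {I} {d} μ b indep k = LF.rankFactorization f λ rf →
    let open LF.RankFactorization rf
        -- `f` takes the same value at S R x and at x because R S is the identity, and independence
        -- of `b` makes `f` injective.
        SR≗id : S LF.∘L R LF.≗ LF.idL
        SR≗id x i = LF.x-y≈0⇒x≈y _ _ (indep _ (λ j → F.trans
          (F.reflexive (≡.cong (LF.span b ⟨$⟩F ((S ⟨$⟩F R ⟨$⟩F x) LF.⊖ x)) (≡.sym (strictlyInverseˡ μ j))))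
          (F.trans (F.sym (CR≗f _ (from μ j)))
            (LF.𝟎-hom C (λ a → F.trans (LF.⊖-hom R _ _ a) (LF.x≈y⇒x-y≈0 (RS≗id _ a))) (from μ j)))) i)
        G = S LF.∘L L
        Gf≗id : G LF.∘L f LF.≗ LF.idL
        Gf≗id x i = F.trans (LF.resp G (λ j → F.sym (CR≗f x j)) i)
          (F.trans (LF.resp S (LC≗id _) i) (SR≗id x i))
        fK : Fin d ⊸ Fin n
        fK = LK.pull (to μ) ∘L LK.span (λ k → ι ∘ b k)
        GfK≗id : lift G ∘L fK ≗ LK.idL
        GfK≗id = LK.ext (lift G ∘L fK) LK.idL λ j i → begin
          (lift G ⟨$⟩ fK ⟨$⟩ LK.e j) i
            ≈⟨ LK.resp (lift G) (λ a → K.trans (LK.lincomb-e (λ k → ι ∘ b k) j (to μ a)) (ι-cong (F.sym (LF.lincomb-e b j (to μ a))))) i ⟩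
          (lift G ⟨$⟩ (ι ∘ (f ⟨$⟩F LF.e j))) i ≈⟨ lift-ι G (f ⟨$⟩F LF.e j) i ⟩
          ι ((G ⟨$⟩F f ⟨$⟩F LF.e j) i)         ≈⟨ ι-cong (Gf≗id (LF.e j) i) ⟩
          ι (LF.e j i)                         ≈⟨ ι-e j i ⟩
          LK.e j i                             ∎
    in k λ cs p → LK.leftInverse⇒injective fK (lift G) GfK≗id (p ∘ to μ)
    where
    f : Fin d ⊸F Fin n
    f = LF.pull (to μ) LF.∘L LF.span b

  -- With a generalized inverse G of Φ, the projection id − GΦ onto the kernel is defined over F.
  kernel-lift : Fin n ↔ I → Fin m ↔ J → (Φ : I ⊸F J) (ΦK : I ⊸ J) →
    (∀ v → (ΦK ⟨$⟩ (ι ∘ v)) ≋ (ι ∘ (Φ ⟨$⟩F v))) →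
    (b : Fin d → I → F.Carrier) →
    (∀ v → (Φ ⟨$⟩F v) LF.≋ LF.𝟎 → ∃ λ cs → ∀ i → v i F.≈ LF.lincomb d cs b i) →
    ¬ ¬ Σ (I ⊸ Fin d) λ Z → ∀ v → (ΦK ⟨$⟩ v) ≋ 𝟎 → v ≋ (LK.span (λ k → ι ∘ b k) ⟨$⟩ Z ⟨$⟩ v)
  kernel-lift {n} {I} {m} {J} {d} μ ν Φ ΦK compat b spans k = LF.rankFactorization Φ′ λ rf →
    let open LF.RankFactorization rf
        G = S LF.∘L L
        Φ′GΦ′≗Φ′ : Φ′ LF.∘L G LF.∘L Φ′ LF.≗ Φ′
        Φ′GΦ′≗Φ′ x i = F.trans (F.sym (CR≗f _ i)) (F.trans (LF.resp C (RS≗id _) i)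
          (F.trans (LF.resp (C LF.∘L L) (λ j → F.sym (CR≗f x j)) i) (F.trans (LF.resp C (LC≗id _) i) (CR≗f x i))))
        P = LF.idL LF.-L G LF.∘L Φ′
        ΦP≋0 : ∀ x → (Φ ⟨$⟩F (P ⟨$⟩F x) ∘ from μ) LF.≋ LF.𝟎
        ΦP≋0 x j = F.trans
          (F.reflexive (≡.cong (Φ ⟨$⟩F (P ⟨$⟩F x) ∘ from μ) (≡.sym (strictlyInverseˡ ν j))))
          (F.trans (LF.⊖-hom Φ′ x (G ⟨$⟩F Φ′ ⟨$⟩F x) (from ν j)) (LF.x≈y⇒x-y≈0 (F.sym (Φ′GΦ′≗Φ′ x (from ν j)))))
        Z , P≗bZ = LF.factor (LF.pull (from μ) LF.∘L P) b (λ k → spans _ (ΦP≋0 (LF.e k)))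
        -- Over F the identity is the sum of G Φ and b Z. As an equation of linear maps over K it
        -- can be checked at the vectors `LK.e k`, which come from F.
        recombined : I-part ∘L lift G ∘L Φ′K LK.+L bK ∘L lift Z ≗ I-part
        recombined = LK.ext (I-part ∘L lift G ∘L Φ′K LK.+L bK ∘L lift Z) I-part λ k i → begin
          (lift G ⟨$⟩ Φ′K ⟨$⟩ LK.e k) (from μ i) K.+ (bK ⟨$⟩ lift Z ⟨$⟩ LK.e k) i
            ≈⟨ K.+-cong
                 (K.trans (LK.resp (lift G ∘L Φ′K) (λ a → K.sym (ι-e k a)) (from μ i))
                   (K.trans (LK.resp (lift G) (λ a → compat (LF.e k ∘ from μ) (to ν a)) (from μ i)) (lift-ι G _ (from μ i))))
                 (K.trans (LK.resp bK (lift-e Z k) i) (K.sym (ι-lincomb d _ b i))) ⟩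
          ι ((G ⟨$⟩F Φ′ ⟨$⟩F LF.e k) (from μ i)) K.+ ι (LF.lincomb d (Z ⟨$⟩F LF.e k) b i)
            ≈⟨ ι-+ _ _ ⟨
          ι ((G ⟨$⟩F Φ′ ⟨$⟩F LF.e k) (from μ i) F.+ LF.lincomb d (Z ⟨$⟩F LF.e k) b i)
            ≈⟨ ι-cong (F.trans (F.+-congˡ (F.sym (P≗bZ (LF.e k) i))) (F.trans (F.+-comm _ _) (LF.[x-y]+y≈x _ _))) ⟩
          ι (LF.e k (from μ i)) ≈⟨ ι-e k (from μ i) ⟩
          LK.e k (from μ i) ∎
        to-from : ∀ (v : I → K.Carrier) → (v ∘ to μ ∘ from μ) ≋ v
        to-from v i = K.reflexive (≡.cong v (strictlyInverseˡ μ i))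
    in k (lift Z ∘L LK.pull (to μ) , λ v ΦKv≋0 i → begin
      v i                                     ≈⟨ to-from v i ⟨
      v (to μ (from μ i))                     ≈⟨ recombined (v ∘ to μ) i ⟨
      (lift G ⟨$⟩ Φ′K ⟨$⟩ v ∘ to μ) (from μ i) K.+ (bK ⟨$⟩ lift Z ⟨$⟩ v ∘ to μ) i
        ≈⟨ K.+-congʳ (LK.𝟎-hom (lift G) (λ a → K.trans (LK.resp ΦK (to-from v) (to ν a)) (ΦKv≋0 (to ν a))) (from μ i)) ⟩
      K.0# K.+ (bK ⟨$⟩ lift Z ⟨$⟩ v ∘ to μ) i ≈⟨ K.+-identityˡ _ ⟩
      (bK ⟨$⟩ lift Z ⟨$⟩ v ∘ to μ) i          ∎)
    where
    Φ′ : Fin n ⊸F Fin m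
    Φ′ = LF.pull (to ν) LF.∘L Φ LF.∘L LF.pull (from μ)
    Φ′K : Fin n ⊸ Fin m
    Φ′K = LK.pull (to ν) ∘L ΦK ∘L LK.pull (from μ)
    I-part : Fin n ⊸ I
    I-part = LK.pull (from μ)
    bK : Fin d ⊸ I
    bK = LK.span (λ k → ι ∘ b k)

  -- The eigenvalue bounds for the commutant over F.

  module CommutantLift {r s} (A : LF.Mat r r) (B : LF.Mat s s) {dC} (dim : LF.IsDim (LF.Commutant A B) dC) where
    private
      AK = liftMat Fb A
      BK = liftMat Fb B
      b  = proj₁ dim
      bK : Fin dC → Fin r × Fin s → K.Carrier
      bK k = ι ∘ b k

    commutator-lift : ∀ X → (LK.commutator AK BK ⟨$⟩ (ι ∘ X)) ≋ (ι ∘ (LF.commutator A B ⟨$⟩F X))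
    commutator-lift X (i , j) = begin
      (AK LK.· (LK.apply (ι ∘ X) ⟨$⟩ LK.e j)) i K.- (LK.apply (ι ∘ X) ⟨$⟩ BK LK.· LK.e j) i
        ≈⟨ LK.-‿cong₂ (LK.resp (LK.mulL AK) apply-e i) (LK.resp (LK.apply (ι ∘ X)) mul-e i) ⟩
      (AK LK.· (ι ∘ (LF.apply X ⟨$⟩F LF.e j))) i K.- (LK.apply (ι ∘ X) ⟨$⟩ (ι ∘ (B LF.· LF.e j))) i
        ≈⟨ LK.-‿cong₂ (ι-· A _ i) (ι-· (λ i k → X (i , k)) _ i) ⟨
      ι ((A LF.· (LF.apply X ⟨$⟩F LF.e j)) i) K.- ι ((LF.apply X ⟨$⟩F B LF.· LF.e j) i)
        ≈⟨ K.+-congˡ (ι-neg _) ⟨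
      ι ((A LF.· (LF.apply X ⟨$⟩F LF.e j)) i) K.+ ι (F.- ((LF.apply X ⟨$⟩F B LF.· LF.e j) i))
        ≈⟨ ι-+ _ _ ⟨
      ι ((LF.commutator A B ⟨$⟩F X) (i , j)) ∎
      where
      apply-e : (LK.apply (ι ∘ X) ⟨$⟩ LK.e j) ≋ (ι ∘ (LF.apply X ⟨$⟩F LF.e j))
      apply-e i = K.trans (LK.apply-e (ι ∘ X) j i) (ι-cong (F.sym (LF.apply-e X j i)))
      mul-e : (BK LK.· LK.e j) ≋ (ι ∘ (B LF.· LF.e j))
      mul-e i = K.trans (LK.mulL-e BK j i) (ι-cong (F.sym (LF.mulL-e B j i)))

    bK-commutes : ∀ k → LK.Commutant AK BK (bK k)
    bK-commutes k = LK.ker⇒commutant AK BK (bK k) λ ij → K.trans (commutator-lift (b k) ij)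
      (K.trans (ι-cong (LF.commutant⇒ker A B (b k) (proj₁ (proj₂ dim) k) ij)) ι-0)

    -- The eigenspace embedding lands in the commutant over K, which is spanned by the lifted
    -- F-basis; composing with coordinates in that basis is an injection into dimension `dC`.
    lower : (kA kB : K.Carrier → ℕ) →
      (∀ α → LK.IsDim (LK.Eigenspace AK α) (kA α)) → (∀ α → LK.IsDim (LK.Eigenspace BK α) (kB α)) →
      ∀ n → LK.FinSupSum (λ α → kA α * kB α) n → n ≤ dC
    lower kA kB dimA dimB _ (l , distinct , _ , ≡.refl) = decidable-stable (_ ℕ.≤? dC) λ n≰dC →
      LK.eigenEmbedding AK BK kA kB dimA dimB l distinct λ (E , n≤size) →
      kernel-lift Finₚ.*↔× Finₚ.*↔× (LF.commutator A B) (LK.commutator AK BK) commutator-lift b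
        (λ v p → proj₂ (proj₂ (proj₂ dim)) v (LF.ker⇒commutant A B v p)) λ (Z , spans) →
      let open LK.EigenEmbedding E in
      n≰dC (ℕₚ.≤-trans n≤size (LK.injective⇒≤′ index ↔-refl (Z ∘L embed) λ x p i k →
        k (injective x (λ ij → K.trans (spans _ (commutes x) ij) (LK.𝟎-hom (LK.span bK) p ij)) i)))

    -- If all `coords` vanish, X vanishes on every sum of generalized eigenvectors, hence on the
    -- standard basis. So X = 0, and independence of the lifted basis gives `cs` = 0.
    upper : (mA mB : K.Carrier → ℕ) →
      (∀ α → LK.IsDim (LK.GenEigenspace AK α) (mA α)) → (∀ α → LK.IsDim (LK.GenEigenspace BK α) (mB α)) →
      ∀ n → LK.FinSupSum (λ α → mA α * mB α) n → dC ≤ n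
    upper mA mB dimA dimB _ (l , _ , support , ≡.refl) = decidable-stable (dC ℕ.≤? _) λ dC≰n →
      independent-lift Finₚ.*↔× b (proj₁ (proj₂ (proj₂ dim))) λ indepK →
      dC≰n (LK.injective⇒≤′ ↔-refl index coords λ cs p i ¬q →
        -- Only finitely many vectors are decomposed, so their double negations combine into one.
        ¬¬-∀Fin (λ j → sumOfGenEigen (LK.mulL BK) (LK.e j)) λ sums →
        ¬q (indepK cs (λ (i , j) → K.trans (K.sym (LK.apply-e (LK.span bK ⟨$⟩ cs) j i))
          (kills-sum cs (kills-all support cs (kills cs p)) (sums j) i)) i))
      where
      open LK.GenEigenCoordinates AK BK mA mB dimA dimB bK bK-commutes
      open Coordinates (coordinates l)
      open LK.AlgebraicallyClosed algClosed

theorem5p1 : ∀ {c ℓ c' ℓ'} (F : Field c ℓ) (Fb : AlgebraicClosure F c' ℓ')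
    (r s : ℕ) (A : LinAlg.Mat F r r) (B : LinAlg.Mat F s s)
    (dC : ℕ) → LinAlg.IsDim F (LinAlg.Commutant F A B) dC →
    (kA kB mA mB : Field.Carrier (AlgebraicClosure.K Fb) → ℕ) →
    (∀ α → LinAlg.IsDim (AlgebraicClosure.K Fb) (LinAlg.Eigenspace (AlgebraicClosure.K Fb) (liftMat Fb A) α) (kA α)) →
    (∀ α → LinAlg.IsDim (AlgebraicClosure.K Fb) (LinAlg.Eigenspace (AlgebraicClosure.K Fb) (liftMat Fb B) α) (kB α)) →
    (∀ α → LinAlg.IsDim (AlgebraicClosure.K Fb) (LinAlg.GenEigenspace (AlgebraicClosure.K Fb) (liftMat Fb A) α) (mA α)) →
    (∀ α → LinAlg.IsDim (AlgebraicClosure.K Fb) (LinAlg.GenEigenspace (AlgebraicClosure.K Fb) (liftMat Fb B) α) (mB α)) →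
    ((∀ n → LinAlg.FinSupSum (AlgebraicClosure.K Fb) (λ α → kA α * kB α) n → n ≤ dC) ×
    (∀ n → LinAlg.FinSupSum (AlgebraicClosure.K Fb) (λ α → mA α * mB α) n → dC ≤ n)) ×
    (∀ ρA ρB → LinAlg.IsRank F A ρA → LinAlg.IsRank F B ρB →
    ((r ∸ ρA) * (s ∸ ρB) ≤ dC) × (dC ≤ (r ∸ ρA) * (s ∸ ρB) + ρA * ρB))
theorem5p1 F Fb r s A B dC dim kA kB mA mB dimkA dimkB dimmA dimmB =
  (lower kA kB dimkA dimkB , upper mA mB dimmA dimmB) , λ ρA ρB rankA rankB →
    decidable-stable ((_ ℕ.≤? dC) ×-dec (dC ℕ.≤? _)) λ ¬bounds →
    decomposition (mulL A) λ DA → decomposition (mulL B) λ DB →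
    ¬bounds (rank-bounds DA DB (isRank⇒≡rank A rankA DA) (isRank⇒≡rank B rankB DB))
  where
  open BaseChange.CommutantLift F Fb A B dim
  open Linear F
  rank-bounds : ∀ {ρA ρB} (DA : Decomposition (mulL A)) (DB : Decomposition (mulL B)) →
    ρA ≡ Decomposition.rank DA → ρB ≡ Decomposition.rank DB →
    ((r ∸ ρA) * (s ∸ ρB) ≤ dC) × (dC ≤ (r ∸ ρA) * (s ∸ ρB) + ρA * ρB)
  rank-bounds DA DB ≡.refl ≡.refl =
    -- The bounds count the kernel of A but the left kernel of B, hence `dim-sum` for one and
    -- `dim-sum′` for the other.
    ≡.subst₂ (λ a b → (a * b ≤ dC) × (dC ≤ a * b + A.rank * B.rank)) (corank≡∸ A.rank A.dim-sum) (corank≡∸ B.rank B.dim-sum′)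
      (RankBounds.lower A B dim DA DB ,
       ≡.subst (dC ≤_) (ℕₚ.+-comm (A.rank * B.rank) _) (RankBounds.upper A B dim DA DB))
    where
    module A = Decomposition DA
    module B = Decomposition DB
    corank≡∸ : ∀ m {k n} → m + k ≡ n → k ≡ n ∸ m
    corank≡∸ m {k} ≡.refl = ≡.sym (ℕₚ.m+n∸m≡n m k)
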